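{- Let $n$ be even, let $\vec p=\{p_{uv}:1\le u<v\le n\}$, $\vec q=\{q_{iu}: i\in[n/2],u\in[n]\}$, and let $A_n(\vec p,\vec q)$ be the CNF consisting of the clauses $q_{i1}\vee\dots\vee q_{in}$ for $i\in[n/2]$; $\neg q_{iu}\vee\neg q_{ju}$ for $i<j$ in $[n/2]$ and $u\in[n]$; $\neg q_{iu}\vee\neg q_{iv}$ for $i\in[n/2]$ and $u<v$ in $[n]$; and $\neg q_{iu}\vee\neg q_{jv}\vee p_{uv}$ for $i\ne j$ in $[n/2]$ and $u<v$ in $[n]$. Let $B_n(\vec p,\vec r_1,\vec r_2)$ be a CNF of size polynomial in $n$, over $\vec p$ and new variable sets $\vec r_1,\vec r_2$, obtained by encoding (with existential variables $\vec r_2$ for the gates) a polynomial-size circuit checking that the $n/2$ vertices specified by $\vec r_1$ do not form a clique in the graph encoded by $\vec p$, so that for every $0/1$ assignment $\vec a$ to $\vec p$, $\forall\vec r_1\exists\vec r_2.\,B_n(\vec a,\vec r_1,\vec r_2)$ is true if and only if $\exists \vec q.\,A_n(\vec a,\vec q)$ is false. Let $\Phi_n=\exists\vec p\,\exists\vec q\,\forall\vec r_1\,\exists\vec r_2.\,A_n(\vec p,\vec q)\wedge B_n(\vec p,\vec r_1,\vec r_2)$ (a false QBF). Then every IRM-calc refutation and every LQU$^+$-Res refutation of $\Phi_n$ has size exponential in $n$.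
   Context: An assignment to $\vec p$ encodes an $n$-vertex graph; $\exists\vec q.\,A_n(\vec a,\vec q)$ expresses that this graph has a clique of size $n/2$ (the $\vec q$ variables select, for each position $i$, exactly one vertex, distinct across positions and pairwise adjacent). LQU$^+$-Res and IRM-calc are QBF resolution calculi operating on prenex QBFs with CNF matrix. LQU$^+$-Res: clauses may contain merged literals $u^*$ for universal $u$; rules are Axiom (matrix clauses), $\forall$-reduction (from $D\vee u$ or $D\vee u^*$ derive $D$ if every existential literal of $D$ has index $\le \mathrm{ind}(u)$), and resolution on an existential or universal pivot $x$: from $C_1\vee U_1\vee x$, $C_2\vee U_2\vee\neg x$ derive $C_1\vee C_2\vee U$ where same-variable literals in $C_1,C_2$ are equal and unmerged, $U_1,U_2$ are universal literals on the same variables each of index $>\mathrm{ind}(x)$, pairs on the same variable are complementary or one is merged, and $U=\{u^*:u\in\mathrm{var}(U_1)\}$. IRM-calc: clauses of annotated existential literals $l^\sigma$ ($\sigma$ maps universal variables of smaller index to $\{0,1,*\}$); rules Axiom (from a matrix clause keep its existential literals annotated by the universal assignment falsifying its universal literals, restricted to smaller indices), Instantiation (extend annotations by a $\{0,1\}$-assignment $\tau$ where not already defined, restricted to smaller indices), Resolution ($x^{\tau\cup\xi}\vee C_1$, $\neg x^{\tau\cup\sigma}\vee C_2$ yield $\mathrm{inst}(\sigma,C_1)\cup\mathrm{inst}(\xi,C_2)$ with disjoint domains, $\tau$ $\{0,1\}$-valued), and Merging ($b^\mu\vee b^\sigma$ with equal domains become $b^\xi$, $\xi$ keeping agreeing values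 and setting $*$ where they differ). Refutations derive the empty clause; size is the number of clauses. -}

module Defs where

open import Data.Nat using (ℕ; zero; suc; _+_; _*_; _≤_; _<_; _<ᵇ_; _/_)
open import Data.Nat.Properties using (<⇒≤)
open import Data.Bool using (Bool; true; false; if_then_else_)
open import Data.Fin using (Fin; toℕ; inject≤)
open import Data.Fin.Properties using (toℕ<n)
open import Data.List using (List; []; _∷_; _++_; map; concatMap; allFin; length)
open import Data.Nat.ListAction using (sum)
open import Data.List.Membership.Propositional using (_∈_)
open import Data.List.Relation.Unary.All using (All)
open import Data.List.Relation.Unary.Any using (Any)
open import Data.Maybe using (Maybe; just; nothing; _<∣>_)
open import Data.Product using (Σ; ∃; _×_; _,_; proj₁; proj₂)
open import Data.Sum using (_⊎_)
open import Data.Empty using (⊥)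
open import Relation.Nullary using (¬_)
open import Relation.Binary.PropositionalEquality using (_≡_; _≢_)

_⇔_ : ∀ {a b} → Set a → Set b → Set _
A ⇔ B = (A → B) × (B → A)

-- A literal is a variable with a polarity: (x , true) is x, (x , false) is ¬x.
Lit : Set → Set
Lit V = V × Bool

CNF : Set → Set
CNF V = List (List (Lit V))

cnfSize : ∀ {V} → CNF V → ℕ
cnfSize F = sum (map (λ C → suc (length C)) F)

Sat : ∀ {V} → (V → Bool) → CNF V → Set
Sat ρ F = All (Any (λ l → ρ (proj₁ l) ≡ proj₂ l)) F

-- Prenex QBFs with CNF matrix.
-- The prefix is given by the index function `ind` (position in the
-- prefix; smaller index = quantified further left) and the quantifier
-- of each variable.

data Quant : Set where
  ∃q ∀q : Quant

record QBF : Set₁ where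
  field
    V      : Set
    ind    : V → ℕ
    quant  : V → Quant
    matrix : CNF V

data LS : Set where
  none pos neg star : LS   -- absent, x, ¬x, merged x*

data Mergeable : LS → LS → Set where
  pn : Mergeable pos neg
  np : Mergeable neg pos
  sl : ∀ {b} → b ≢ none → Mergeable star b
  sr : ∀ {a} → a ≢ none → Mergeable a star

module LQU (Φ : QBF) where
  open QBF Φ

  LClause : Set
  LClause = V → LS

  Represents : List (Lit V) → LClause → Set
  Represents M C = ∀ v → ((C v ≡ pos) ⇔ ((v , true) ∈ M))
                       × ((C v ≡ neg) ⇔ ((v , false) ∈ M))
                       × (C v ≢ star)

  -- behaviour of resolution (pivot x) at a non-pivot variable v:
  -- premises contain a resp. b on v, the resolvent contains r.
  data ResV (x v : V) : LS → LS → LS → Set where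
    left  : ∀ {b} → ResV x v none b b
    right : ∀ {a} → ResV x v a none a
    same  : ∀ {a} → a ≢ star → ResV x v a a a
    merge : ∀ {a b} → quant v ≡ ∀q → ind x < ind v → Mergeable a b
          → ResV x v a b star

  data LStep (prev : List LClause) (C : LClause) : Set where
    axiom  : (M : List (Lit V)) → M ∈ matrix → Represents M C → LStep prev C
    reduce : (D : LClause) → D ∈ prev → (u : V) → quant u ≡ ∀q → D u ≢ none
           → C u ≡ none → (∀ v → v ≢ u → C v ≡ D v)
           → (∀ e → quant e ≡ ∃q → C e ≢ none → ind e ≤ ind u)
           → LStep prev C
    resolve : (C₁ C₂ : LClause) → C₁ ∈ prev → C₂ ∈ prev → (x : V)
           → C₁ x ≡ pos → C₂ x ≡ neg → C x ≡ none
           → (∀ v → v ≢ x → ResV x v (C₁ v) (C₂ v) (C v))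
           → LStep prev C

  data Derivation : List LClause → Set where
    []  : Derivation []
    _∷_ : ∀ {C cs} → LStep cs C → Derivation cs → Derivation (C ∷ cs)

  IsEmpty : LClause → Set
  IsEmpty C = ∀ v → C v ≡ none

  record Refutation : Set where
    field
      final   : LClause
      earlier : List LClause
      steps   : Derivation (final ∷ earlier)
      empty   : IsEmpty final

  size : Refutation → ℕ
  size π = suc (length (Refutation.earlier π))

data V3 : Set where
  𝟘 𝟙 ✱ : V3

eqM : Maybe V3 → Maybe V3 → Bool
eqM nothing  nothing  = true
eqM (just 𝟘) (just 𝟘) = true
eqM (just 𝟙) (just 𝟙) = true
eqM (just ✱) (just ✱) = true
eqM _        _        = false

module IRM (Φ : QBF) where
  open QBF Φ

  Ann : Set
  Ann = V → Maybe V3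

  record ALit : Set where
    constructor ⟨_,_,_⟩
    field
      var : V
      pol : Bool
      ann : Ann
  open ALit

  _≈L_ : ALit → ALit → Set
  l ≈L l' = (var l ≡ var l') × (pol l ≡ pol l') × (∀ u → ann l u ≡ ann l' u)

  IClause : Set₁
  IClause = ALit → Set

  _∪_ : Ann → Ann → Ann
  (τ ∪ ξ) u = τ u <∣> ξ u

  ext : V → Ann → Ann → Ann
  ext x τ ρ u = ρ u <∣> (if ind u <ᵇ ind x then τ u else nothing)

  instL : Ann → ALit → ALit
  instL τ l = ⟨ var l , pol l , ext (var l) τ (ann l) ⟩

  mergeAnn : Ann → Ann → Ann
  mergeAnn μ σ u = if eqM (μ u) (σ u) then μ u else just ✱

  -- annotation of the existential e in the axiom for matrix clause M:
  -- the assignment falsifying the universal literals of M, restricted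
  -- to universals of index < ind e
  data AxAnn (M : List (Lit V)) (e u : V) : Maybe V3 → Set where
    a0 : quant u ≡ ∀q → ind u < ind e → (u , true) ∈ M → AxAnn M e u (just 𝟘)
    a1 : quant u ≡ ∀q → ind u < ind e → (u , false) ∈ M → AxAnn M e u (just 𝟙)
    aN : (quant u ≡ ∀q → ind u < ind e → ¬ (((u , true) ∈ M) ⊎ ((u , false) ∈ M)))
       → AxAnn M e u nothing

  AxLit : List (Lit V) → ALit → Set
  AxLit M l = (quant (var l) ≡ ∃q) × ((var l , pol l) ∈ M)
            × (∀ u → AxAnn M (var l) u (ann l u))

  Disjoint : Ann → Ann → Set
  Disjoint τ ξ = ∀ u → (τ u ≡ nothing) ⊎ (ξ u ≡ nothing)

  data IStep (prev : List IClause) (C : IClause) : Set₁ where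
    axiom : (M : List (Lit V)) → M ∈ matrix
          → (∀ u → quant u ≡ ∀q → (u , true) ∈ M → (u , false) ∈ M → ⊥)
          → (∀ l → C l ⇔ AxLit M l)
          → IStep prev C
    instantiate : (D : IClause) → D ∈ prev → (τ : Ann)
          → (∀ u → τ u ≢ nothing → quant u ≡ ∀q)
          → (∀ u → τ u ≢ just ✱)
          → (∀ l → C l ⇔ Σ ALit (λ l' → D l' × (l ≈L instL τ l')))
          → IStep prev C
    resolve : (D₁ D₂ : IClause) → D₁ ∈ prev → D₂ ∈ prev → (x : V)
          → (τ ξ σ : Ann)
          → (∀ u → τ u ≢ just ✱)
          → Disjoint τ ξ → Disjoint τ σ → Disjoint ξ σ
          → D₁ ⟨ x , true , τ ∪ ξ ⟩ → D₂ ⟨ x , false , τ ∪ σ ⟩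
          → (∀ l → C l ⇔
               (Σ ALit (λ l₁ → D₁ l₁ × ¬ (l₁ ≈L ⟨ x , true , τ ∪ ξ ⟩) × (l ≈L instL σ l₁))
               ⊎ Σ ALit (λ l₂ → D₂ l₂ × ¬ (l₂ ≈L ⟨ x , false , τ ∪ σ ⟩) × (l ≈L instL ξ l₂))))
          → IStep prev C
    merge : (D : IClause) → D ∈ prev → (b : V) → (p : Bool) → (μ σ : Ann)
          → D ⟨ b , p , μ ⟩ → D ⟨ b , p , σ ⟩
          → (∀ u → (μ u ≡ nothing) ⇔ (σ u ≡ nothing))
          → (∀ l → C l ⇔
               ((D l × ¬ (l ≈L ⟨ b , p , μ ⟩) × ¬ (l ≈L ⟨ b , p , σ ⟩))
               ⊎ (l ≈L ⟨ b , p , mergeAnn μ σ ⟩)))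
          → IStep prev C

  data Derivation : List IClause → Set₁ where
    []  : Derivation []
    _∷_ : ∀ {C cs} → IStep cs C → Derivation cs → Derivation (C ∷ cs)

  IsEmpty : IClause → Set
  IsEmpty C = ∀ l → ¬ C l

  record Refutation : Set₁ where
    field
      final   : IClause
      earlier : List IClause
      steps   : Derivation (final ∷ earlier)
      empty   : IsEmpty final

  size : Refutation → ℕ
  size π = suc (length (Refutation.earlier π))

-- p-variables p_{uv}, u < v: `v` together with `u : Fin (toℕ v)`.
-- the vertex u as an element of Fin n:
vtx : ∀ {n} (v : Fin n) → Fin (toℕ v) → Fin n
vtx v u = inject≤ u (<⇒≤ (toℕ<n v))

PAssign : ℕ → Set
PAssign n = (v : Fin n) → Fin (toℕ v) → Bool

data AVar (n : ℕ) : Set where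
  ap : (v : Fin n) → Fin (toℕ v) → AVar n
  aq : Fin (n / 2) → Fin n → AVar n

data BVar (n m₁ m₂ : ℕ) : Set where
  bp  : (v : Fin n) → Fin (toℕ v) → BVar n m₁ m₂
  br₁ : Fin m₁ → BVar n m₁ m₂
  br₂ : Fin m₂ → BVar n m₁ m₂

pairs : (n : ℕ) → List (Σ (Fin n) (λ v → Fin (toℕ v)))
pairs n = concatMap (λ v → map (λ u → (v , u)) (allFin (toℕ v))) (allFin n)

pairsNe pairsLt : (k : ℕ) → List (Fin k × Fin k)
pairsNe k = concatMap (λ i → concatMap (λ j →
              if toℕ i <ᵇ toℕ j then (i , j) ∷ []
              else if toℕ j <ᵇ toℕ i then (i , j) ∷ [] else []) (allFin k)) (allFin k)
pairsLt k = concatMap (λ i → concatMap (λ j →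
              if toℕ i <ᵇ toℕ j then (i , j) ∷ [] else []) (allFin k)) (allFin k)

A : (n : ℕ) → CNF (AVar n)
A n =
     map (λ i → map (λ u → (aq i u , true)) (allFin n)) (allFin (n / 2))
  ++ concatMap (λ ij → map (λ u →
        (aq (proj₁ ij) u , false) ∷ (aq (proj₂ ij) u , false) ∷ []) (allFin n))
       (pairsLt (n / 2))
  ++ concatMap (λ i → map (λ vu →
        (aq i (vtx (proj₁ vu) (proj₂ vu)) , false) ∷ (aq i (proj₁ vu) , false) ∷ [])
        (pairs n)) (allFin (n / 2))
  ++ concatMap (λ ij → map (λ vu →
        (aq (proj₁ ij) (vtx (proj₁ vu) (proj₂ vu)) , false)
        ∷ (aq (proj₂ ij) (proj₁ vu) , false)
        ∷ (ap (proj₁ vu) (proj₂ vu) , true) ∷ [])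
        (pairs n)) (pairsNe (n / 2))

aAssign : ∀ {n} → PAssign n → (Fin (n / 2) → Fin n → Bool) → AVar n → Bool
aAssign a s (ap v u) = a v u
aAssign a s (aq i u) = s i u

bAssign : ∀ {n m₁ m₂} → PAssign n → (Fin m₁ → Bool) → (Fin m₂ → Bool)
        → BVar n m₁ m₂ → Bool
bAssign a s₁ s₂ (bp v u) = a v u
bAssign a s₁ s₂ (br₁ j)  = s₁ j
bAssign a s₁ s₂ (br₂ j)  = s₂ j

data PhiVar (n m₁ m₂ : ℕ) : Set where
  vp  : (v : Fin n) → Fin (toℕ v) → PhiVar n m₁ m₂
  vq  : Fin (n / 2) → Fin n → PhiVar n m₁ m₂
  vr₁ : Fin m₁ → PhiVar n m₁ m₂
  vr₂ : Fin m₂ → PhiVar n m₁ m₂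

embA : ∀ {n m₁ m₂} → AVar n → PhiVar n m₁ m₂
embA (ap v u) = vp v u
embA (aq i u) = vq i u

embB : ∀ {n m₁ m₂} → BVar n m₁ m₂ → PhiVar n m₁ m₂
embB (bp v u) = vp v u
embB (br₁ j)  = vr₁ j
embB (br₂ j)  = vr₂ j

embCNF : ∀ {V W} → (V → W) → CNF V → CNF W
embCNF f = map (map (λ l → (f (proj₁ l) , proj₂ l)))

-- prefix  ∃p ∃q ∀r₁ ∃r₂  (variables of a block ordered as enumerated)
phiInd : ∀ {n m₁ m₂} → PhiVar n m₁ m₂ → ℕ
phiInd {n} (vp v u) = toℕ v * n + toℕ (vtx v u)
phiInd {n} (vq i u) = n * n + (toℕ i * n + toℕ u)
phiInd {n} (vr₁ j)  = n * n + (n / 2) * n + toℕ j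
phiInd {n} {m₁} (vr₂ j) = n * n + (n / 2) * n + m₁ + toℕ j

phiQuant : ∀ {n m₁ m₂} → PhiVar n m₁ m₂ → Quant
phiQuant (vp _ _) = ∃q
phiQuant (vq _ _) = ∃q
phiQuant (vr₁ _)  = ∀q
phiQuant (vr₂ _)  = ∃q

Phi : (n m₁ m₂ : ℕ) → CNF (BVar n m₁ m₂) → QBF
Phi n m₁ m₂ B = record
  { V      = PhiVar n m₁ m₂
  ; ind    = phiInd
  ; quant  = phiQuant
  ; matrix = embCNF embA (A n) ++ embCNF embB B
  }

{-# OPTIONS --safe #-}
-- Feasible monotone interpolation reduces refutation size to monotone program
-- size.  Fix an assignment a to p.  Every line of a refutation carries one bit:
-- 0 means that the p,q-part of its clause follows from A_n(a), 1 means that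
-- the universal player can answer for its r-part in B_n(a).  Since p occurs only
-- positively in A_n, these bits are computed by a monotone program in a, and the
-- bit of the empty clause says whether the graph a has a clique of size n / 2.
--
-- The program is then approximated gate by gate by a DNF whose terms are small
-- vertex sets and a CNF whose clauses are small partitions, every term meeting
-- every clause.  Rewriting a CNF as a DNF, or conversely, is a branching of
-- bounded depth ℓ; only the paths that reach depth ℓ cause errors, and each of
-- them accounts for a fraction Q ^ -ℓ of all cliques (or colourings).  With
-- (2ℓ)² branches per node and Q = 16ℓ² one gate spoils at most a 4 ^ -ℓ fraction
-- of the tests, so about 4 ^ ℓ gates are needed.
module Submission where

open import Defs
open import Data.Nat using (ℕ; zero; suc; pred; _+_; _*_; _^_; _∸_; _≤_; _<_; z≤n; s≤s; NonZero; >-nonZero; _/_; _<ᵇ_)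
open import Data.Nat.Properties hiding (_≟_)
open import Data.Nat.DivMod using (m*n/n≡m; /-monoˡ-≤; m/n*n≤m)
open import Data.Nat.Divisibility using (_∣_)
open import Data.Nat.Tactic.RingSolver using (solve-∀)
open import Data.Fin using (Fin; zero; suc; toℕ; fromℕ<; cast; splitAt; join; _≟_; punchIn; punchOut; combine; quotient; remainder;
  finToFun; funToFin)
open import Data.Fin.Properties using (injective⇒≤; funToFin-finToFin; finToFun-funToFin; punchIn-punchOut; punchOut-injective;
  punchOut-cong; combine-remQuot; remQuot-combine; toℕ<n; toℕ-injective; toℕ-fromℕ<; toℕ-inject≤; splitAt-join; join-splitAt;
  cast-involutive; pigeonhole; all?; combine-injectiveˡ)
open import Data.Bool using (Bool; true; false; T; not; _∧_; _∨_; if_then_else_)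
open import Data.Bool.Properties using (not-¬; ¬-not) renaming (_≟_ to _≟ᵇ_)
open import Data.Maybe using (Maybe; just; nothing; _<∣>_; fromMaybe)
open import Data.Maybe.Properties using (<∣>-identityʳ)
open import Data.List using (List; []; _∷_; _++_; map; concatMap; allFin; length; lookup; cartesianProduct)
open import Data.List.Properties using (length-map; length-++; length-tabulate)
open import Data.List.Membership.Propositional using (_∈_; find; lose)
open import Data.List.Membership.Propositional.Properties
  using (∈-map⁺; ∈-map⁻; ∈-concatMap⁺; ∈-allFin; ∈-++⁺ˡ; ∈-++⁺ʳ; ∈-++⁻; ∈-cartesianProduct⁺; ∈-cartesianProduct⁻)
open import Data.List.Membership.DecPropositional using (_∈?_)
open import Data.List.Relation.Unary.All as All using (All; []; _∷_)
import Data.List.Relation.Unary.All.Properties as Allₚ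
open import Data.List.Relation.Unary.Any as Any using (Any; here; there; index)
import Data.List.Relation.Unary.Any.Properties as Anyₚ
open import Data.Product using (Σ; ∃; ∃₂; _×_; _,_; proj₁; proj₂; uncurry)
open import Data.Product.Properties using (≡-dec)
open import Data.Sum using (_⊎_; inj₁; inj₂; [_,_]; [_,_]′; map₂)
open import Data.Sum.Properties using (inj₁-injective)
open import Data.Empty using (⊥; ⊥-elim)
open import Data.Unit using (⊤; tt)
open import Function using (_∘_; id; case_of_)
open import Relation.Nullary using (¬_; Dec; yes; no; contradiction)
open import Relation.Nullary.Decidable using (⌊_⌋; _×-dec_; ¬?)
open import Relation.Binary.Definitions using (tri<; tri≈; tri>)
open import Relation.Binary.PropositionalEquality hiding ([_])

-- Covering function spaces by subcubes

-- Both families of tests are full function spaces into `Fin Q`: a slot for each block, or a colour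
-- for each vertex. Fixing a slot and identifying two colours therefore cost the same factor Q, and
-- errors are counted by a union bound over subcubes, without probabilities or sunflowers. The
-- clique has to exceed the number of colours by one, hence `suc Q` blocks. This core has about 256
-- ℓ⁴ vertices, whereas A_n asks for a clique of size n / 2; padding closes the gap, and the size of
-- the core is what limits ℓ to a root of n. On the side of the refutations the obstacle is the
-- universal player. A merged literal u* does not say which value of u falsifies it, so for LQU⁺-Res
-- the evidence for B is a strategy that computes every r₁-value from earlier ones, and resolution
-- on a universal pivot lets later answers depend on the value of the pivot. In IRM-calc the
-- annotations themselves name the answers, so a partial assignment to r₁ is enough.

length-concatMap-≤ : {A B : Set} (f : A → List B) (b : ℕ) (xs : List A) →
  (∀ x → length (f x) ≤ b) → length (concatMap f xs) ≤ length xs * b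
length-concatMap-≤ f b []       bnd = z≤n
length-concatMap-≤ f b (x ∷ xs) bnd =
  subst (_≤ b + length xs * b) (sym (length-++ (f x))) (+-mono-≤ (bnd x) (length-concatMap-≤ f b xs bnd))

-- The position of `y` in the list determines `y`, so taking positions is injective.
exhaustive⇒≤length : ∀ {M} (ys : List (Fin M)) → (∀ y → y ∈ ys) → M ≤ length ys
exhaustive⇒≤length ys all∈ = injective⇒≤ {f = λ y → index (all∈ y)} λ {y} {z} eq →
  trans (Anyₚ.lookup-index (all∈ y)) (trans (cong (lookup ys) eq) (sym (Anyₚ.lookup-index (all∈ z))))

funToFin-cong : ∀ {m n} {f g : Fin m → Fin n} → (∀ i → f i ≡ g i) → funToFin f ≡ funToFin g
funToFin-cong {zero}  f≗g = refl
funToFin-cong {suc m} f≗g = cong₂ combine (f≗g zero) (funToFin-cong (f≗g ∘ suc))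

-- A subcube of Fin N → Fin Q with m degrees of freedom: every coordinate is
-- either one of the m parameters or a constant.
Subcube : ℕ → ℕ → Set
Subcube N Q = Σ ℕ λ m → Fin N → Fin m ⊎ Fin Q

_⊑_ : ∀ {N Q} → (Fin N → Fin Q) → Subcube N Q → Set
f ⊑ (m , ψ) = ∃ λ g → ∀ i → f i ≡ [ g , id ] (ψ i)

module _ {N Q : ℕ} .{{_ : NonZero Q}} where

  points : Subcube N Q → List (Fin (Q ^ N))
  points (m , ψ) = map (λ z → funToFin ([ finToFun {Q} {m} z , id ] ∘ ψ)) (allFin (Q ^ m))

  ∈-points : ∀ y p → finToFun {Q} {N} y ⊑ p → y ∈ points p
  ∈-points y (m , ψ) (g , eq) = subst (_∈ points (m , ψ)) same (∈-map⁺ _ (∈-allFin (funToFin g)))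
    where
    back : ∀ s → [ finToFun {Q} {m} (funToFin g) , id ] s ≡ [ g , id ] s
    back (inj₁ x) = finToFun-funToFin g x
    back (inj₂ x) = refl
    same : funToFin ([ finToFun {Q} {m} (funToFin g) , id ] ∘ ψ) ≡ y
    same = trans (funToFin-cong λ i → trans (back (ψ i)) (sym (eq i))) (funToFin-finToFin {N} {Q} y)

  length-points : ∀ {M} ps → All ((_≤ M) ∘ proj₁) ps → length (concatMap points ps) ≤ length ps * Q ^ M
  length-points []             []         = z≤n
  length-points {M} ((m , ψ) ∷ ps) (m≤M ∷ ps≤M) =
    subst (_≤ Q ^ M + length ps * Q ^ M) (sym (length-++ (points (m , ψ))))
      (+-mono-≤ (≤-trans (≤-reflexive (trans (length-map _ (allFin (Q ^ m))) (length-tabulate id)))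
                         (^-monoʳ-≤ Q m≤M))
                (length-points ps ps≤M))

  -- The union bound. Two families with separate dimensions are allowed because the negative case
  -- adds subcubes of codimension one to the much smaller error subcubes.
  cover⇒≤ : ∀ {M M'} ps ps' → All ((_≤ M) ∘ proj₁) ps → All ((_≤ M') ∘ proj₁) ps' →
    (∀ (f : Fin N → Fin Q) → Any (f ⊑_) ps ⊎ Any (f ⊑_) ps') →
    Q ^ N ≤ length ps * Q ^ M + length ps' * Q ^ M'
  cover⇒≤ ps ps' ps≤M ps'≤M' cover =
    ≤-trans (exhaustive⇒≤length (concatMap points ps ++ concatMap points ps') listed)
      (≤-trans (≤-reflexive (length-++ (concatMap points ps)))
               (+-mono-≤ (length-points ps ps≤M) (length-points ps' ps'≤M')))
    where
    listed : ∀ y → y ∈ concatMap points ps ++ concatMap points ps'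
    listed y with cover (finToFun y)
    ... | inj₁ c = ∈-++⁺ˡ (∈-concatMap⁺ points (Any.map (λ {p} → ∈-points y p) c))
    ... | inj₂ c = ∈-++⁺ʳ (concatMap points ps) (∈-concatMap⁺ points (Any.map (λ {p} → ∈-points y p) c))

-- Branching tree that processes a list of objects one after the other.  A state
-- that already hits the current object is kept, otherwise it branches.  The
-- index of a state is the number of branchings still allowed on its path.
record Branching (Obj Test : Set) (b : ℕ) : Set₁ where
  field
    State  : ℕ → Set
    Hit    : ∀ {e} → Obj → State e → Set
    hit?   : ∀ {e} o (S : State e) → Dec (Hit o S)
    branch : ∀ {e} → Obj → State (suc e) → List (State e)
    Fits   : ∀ {e} → Test → State e → Set
    Meets  : Test → Obj → Set
    branch-length : ∀ {e} o (S : State (suc e)) → length (branch o S) ≤ b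
    branch-fits   : ∀ {e} t o (S : State (suc e)) → ¬ Hit o S → Fits t S → Meets t o → Any (Fits t) (branch o S)
    branch-hits   : ∀ {e} o (S : State (suc e)) → All (Hit o) (branch o S)
    branch-keeps  : ∀ {e} o o' (S : State (suc e)) → Hit o' S → All (Hit o') (branch o S)

  -- A path whose index reaches 0 is given up even if no object is left. So leaves have a positive
  -- index, and an error has always used up every branching allowed at the start; this fixes how
  -- small its subcube is.
  leaves : ∀ {e} → State e → List Obj → List (Σ ℕ State)
  leaves {zero}  S os       = []
  leaves {suc e} S []       = (suc e , S) ∷ []
  leaves {suc e} S (o ∷ os) with hit? o S
  ... | yes _ = leaves S os
  ... | no  _ = concatMap (λ S' → leaves S' os) (branch o S)

  errors : ∀ {e} → State e → List Obj → List (State 0)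
  errors {zero}  S os       = S ∷ []
  errors {suc e} S []       = []
  errors {suc e} S (o ∷ os) with hit? o S
  ... | yes _ = errors S os
  ... | no  _ = concatMap (λ S' → errors S' os) (branch o S)

  errors-length : ∀ {e} .{{_ : NonZero b}} (S : State e) os → length (errors S os) ≤ b ^ e
  errors-length {zero}  S os       = ≤-refl
  errors-length {suc e} S []       = z≤n
  errors-length {suc e} S (o ∷ os) with hit? o S
  ... | yes _ = errors-length S os
  ... | no  _ = ≤-trans (length-concatMap-≤ _ (b ^ e) (branch o S) (λ S' → errors-length S' os))
                        (*-monoˡ-≤ (b ^ e) (branch-length o S))

  -- By `branch-fits` a test that fits a state fits one of its branches, so it can be followed along
  -- a single path to a leaf or to an error.
  fits-somewhere : ∀ {e} t (S : State e) os → Fits t S → All (Meets t) os →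
    Any (Fits t) (errors S os) ⊎ Any (Fits t ∘ proj₂) (leaves S os)
  fits-somewhere {zero}  t S os       f ms = inj₁ (here f)
  fits-somewhere {suc e} t S []       f ms = inj₂ (here f)
  fits-somewhere {suc e} t S (o ∷ os) f (m ∷ ms) with hit? o S
  ... | yes _ = fits-somewhere t S os f ms
  ... | no ¬h = go (branch o S) (branch-fits t o S ¬h f m)
    where
    go : ∀ Ss → Any (Fits t) Ss →
      Any (Fits t) (concatMap (λ S' → errors S' os) Ss) ⊎ Any (Fits t ∘ proj₂) (concatMap (λ S' → leaves S' os) Ss)
    go (S' ∷ Ss) (here f')  = [ inj₁ ∘ Anyₚ.++⁺ˡ , inj₂ ∘ Anyₚ.++⁺ˡ ] (fits-somewhere t S' os f' ms)
    go (S' ∷ Ss) (there fs) = [ inj₁ ∘ Anyₚ.++⁺ʳ _ , inj₂ ∘ Anyₚ.++⁺ʳ _ ] (go Ss fs)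

  leaves-keep : ∀ {e} o (S : State e) os → Hit o S → All (Hit o ∘ proj₂) (leaves S os)
  leaves-keep {zero}  o S os        h = []
  leaves-keep {suc e} o S []        h = h ∷ []
  leaves-keep {suc e} o S (o' ∷ os) h with hit? o' S
  ... | yes _ = leaves-keep o S os h
  ... | no  _ = go (branch o' S) (branch-keeps o' o S h)
    where
    go : ∀ Ss → All (Hit o) Ss → All (Hit o ∘ proj₂) (concatMap (λ S' → leaves S' os) Ss)
    go []        []        = []
    go (S' ∷ Ss) (h' ∷ hs) = Allₚ.++⁺ (leaves-keep o S' os h') (go Ss hs)

  -- An object is hit once it has been processed, by the check or by `branch-hits`, and no later
  -- branching undoes a hit.
  leaves-hit : ∀ {e} (S : State e) os → All (λ o → All (Hit o ∘ proj₂) (leaves S os)) os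
  leaves-hit {e}     S []       = []
  leaves-hit {zero}  S (o ∷ os) = [] ∷ All.universal (λ _ → []) os
  leaves-hit {suc e} S (o ∷ os) with hit? o S
  ... | yes h = leaves-keep o S os h ∷ leaves-hit S os
  ... | no  _ = go (branch o S) (branch-hits o S) ∷ All.tabulate (λ {o'} o'∈ → rest o' o'∈ (branch o S))
    where
    go : ∀ Ss → All (Hit o) Ss → All (Hit o ∘ proj₂) (concatMap (λ S' → leaves S' os) Ss)
    go []        []        = []
    go (S' ∷ Ss) (h ∷ hs) = Allₚ.++⁺ (leaves-keep o S' os h) (go Ss hs)
    rest : ∀ o' → o' ∈ os → ∀ Ss → All (Hit o' ∘ proj₂) (concatMap (λ S' → leaves S' os) Ss)
    rest o' o'∈ []        = []
    rest o' o'∈ (S' ∷ Ss) = Allₚ.++⁺ (All.lookup (leaves-hit S' os) o'∈) (rest o' o'∈ Ss)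

-- Straight-line monotone programs; the gate sel x i j computes j ∧ (x ∨ i), the
-- monotone selector that interpolation needs for a pivot shared by both parts.
data Gate (X : Set) (l : ℕ) : Set where
  const  : Bool → Gate X l
  copy   : Fin l → Gate X l
  and or : Fin l → Fin l → Gate X l
  sel    : X → Fin l → Fin l → Gate X l

data Prog (X : Set) : ℕ → Set where
  []  : Prog X 0
  _∷_ : ∀ {l} → Gate X l → Prog X l → Prog X (suc l)

gateVal : ∀ {X l} → (X → Bool) → (Fin l → Bool) → Gate X l → Bool
gateVal a val (const b)   = b
gateVal a val (copy i)    = val i
gateVal a val (and i j)   = val i ∧ val j
gateVal a val (or i j)    = val i ∨ val j
gateVal a val (sel x i j) = val j ∧ (a x ∨ val i)

progVal : ∀ {X l} → Prog X l → (X → Bool) → Fin l → Bool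
progVal (g ∷ P) a zero    = gateVal a (progVal P a) g
progVal (g ∷ P) a (suc i) = progVal P a i

-- Lists, quotients of finite sets, and colliding pairs

∈-Any-concatMap : {A B : Set} {P : B → Set} (f : A → List B) {x : A} {xs : List A} →
  x ∈ xs → Any P (f x) → Any P (concatMap f xs)
∈-Any-concatMap f x∈ p = Anyₚ.concat⁺ (Anyₚ.map⁺ (lose x∈ p))

All-concatMap : {A B : Set} {P : B → Set} (f : A → List B) (xs : List A) →
  (∀ {x} → x ∈ xs → All P (f x)) → All P (concatMap f xs)
All-concatMap f xs h = Allₚ.concat⁺ (Allₚ.map⁺ (All.tabulate h))

length-cartesianProduct : {A B : Set} (xs : List A) (ys : List B) →
  length (cartesianProduct xs ys) ≡ length xs * length ys
length-cartesianProduct []       ys = refl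
length-cartesianProduct (x ∷ xs) ys =
  trans (length-++ (map (x ,_) ys)) (cong₂ _+_ (length-map (x ,_) ys) (length-cartesianProduct xs ys))

-- The quotient map that identifies `a` with `b`: the point `a` is deleted and sent to the image of
-- `b`. The codomain is `pred m` since the number of parts is not syntactically a successor where
-- the map is applied.
mergeFin : ∀ {m} {a b : Fin m} → a ≢ b → Fin m → Fin (pred m)
mergeFin {suc m} {a} a≢b w with a ≟ w
... | yes _   = punchOut a≢b
... | no  a≢w = punchOut a≢w

mergeFin-joins : ∀ {m} {a b : Fin m} (a≢b : a ≢ b) → mergeFin a≢b a ≡ mergeFin a≢b b
mergeFin-joins {suc m} {a} {b} a≢b with a ≟ a | a ≟ b
... | yes _   | yes a≡b = contradiction a≡b a≢b
... | yes _   | no  _   = punchOut-cong a refl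
... | no  a≢a | _       = contradiction refl a≢a

mergeFin-kernel : ∀ {m} {a b : Fin m} (a≢b : a ≢ b) {w w'} →
  mergeFin a≢b w ≡ mergeFin a≢b w' → w ≡ w' ⊎ w ≡ a ⊎ w ≡ b
mergeFin-kernel {suc m} {a} a≢b {w} {w'} eq with a ≟ w | a ≟ w'
... | yes a≡w | _       = inj₂ (inj₁ (sym a≡w))
... | no  a≢w | yes _   = inj₂ (inj₂ (punchOut-injective a≢w a≢b eq))
... | no  a≢w | no a≢w' = inj₁ (punchOut-injective a≢w a≢w' eq)

-- The source of the factor Q on the negative side: functions that agree on `a` and `b` need one
-- parameter fewer. `fixFin-factor` is the positive counterpart.
mergeFin-factor : ∀ {m} {X : Set} {a b : Fin m} (a≢b : a ≢ b) (g : Fin m → X) → g a ≡ g b →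
  ∃ λ (g' : Fin (pred m) → X) → ∀ w → g w ≡ g' (mergeFin a≢b w)
mergeFin-factor {suc m} {a = a} a≢b g ga≡gb = g ∘ punchIn a , λ w → eq w
  where
  eq : ∀ w → g w ≡ g (punchIn a (mergeFin a≢b w))
  eq w with a ≟ w
  ... | yes refl = trans ga≡gb (cong g (sym (punchIn-punchOut a≢b)))
  ... | no  a≢w  = cong g (sym (punchIn-punchOut a≢w))

fixFin : ∀ {m} {X : Set} → Fin m → X → Fin m → Fin (pred m) ⊎ X
fixFin {suc m} a x w with a ≟ w
... | yes _   = inj₂ x
... | no  a≢w = inj₁ (punchOut a≢w)

fixFin-constant : ∀ {m} {X : Set} (a : Fin m) (x : X) {w y} → fixFin a x w ≡ inj₂ y → w ≡ a × x ≡ y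
fixFin-constant {suc m} a x {w} eq with a ≟ w
fixFin-constant {suc m} a x {w} refl | yes a≡w = sym a≡w , refl
fixFin-constant {suc m} a x {w} ()   | no _

fixFin-injective : ∀ {m} {X : Set} (a : Fin m) (x : X) {w w' c} →
  fixFin a x w ≡ inj₁ c → fixFin a x w' ≡ inj₁ c → w ≡ w'
fixFin-injective {suc m} a x {w} {w'} eq eq' with a ≟ w | a ≟ w'
fixFin-injective {suc m} a x () eq'     | yes _   | _
fixFin-injective {suc m} a x eq ()      | no  _   | yes _
fixFin-injective {suc m} a x refl eq'   | no  a≢w | no a≢w' =
  punchOut-injective a≢w a≢w' (sym (inj₁-injective eq'))

fixFin-factor : ∀ {m} {X : Set} (a : Fin m) (x : X) (g : Fin m → X) → g a ≡ x →
  ∃ λ (g' : Fin (pred m) → X) → ∀ w → g w ≡ [ g' , id ] (fixFin a x w)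
fixFin-factor {suc m} a x g ga≡x = g ∘ punchIn a , λ w → eq w
  where
  eq : ∀ w → g w ≡ [ g ∘ punchIn a , id ] (fixFin a x w)
  eq w with a ≟ w
  ... | yes refl = ga≡x
  ... | no  a≢w  = cong g (sym (punchIn-punchOut a≢w))

-- For a partition `φ`: the clique on `W` has an edge inside a part. For a colouring `φ`: `W` is not
-- a clique of the complete multipartite graph.
Collide : {V A : Set} → (V → A) → List V → Set
Collide φ W = Any (λ u → Any (λ v → u ≢ v × φ u ≡ φ v) W) W

collide : {V A : Set} {φ : V → A} {W : List V} {u v : V} → u ∈ W → v ∈ W → u ≢ v → φ u ≡ φ v → Collide φ W
collide u∈ v∈ u≢v eq = lose u∈ (lose v∈ (u≢v , eq))

collision : {V A : Set} {φ : V → A} {W : List V} → Collide φ W →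
  ∃₂ λ u v → u ∈ W × v ∈ W × u ≢ v × φ u ≡ φ v
collision c with find c
... | u , u∈ , c' with find c'
... | v , v∈ , u≢v , eq = u , v , u∈ , v∈ , u≢v , eq

Collide-mono : {V A B : Set} {φ : V → A} {ψ : V → B} {W W' : List V} →
  (∀ {w} → w ∈ W → w ∈ W') → (∀ {u v} → φ u ≡ φ v → ψ u ≡ ψ v) → Collide φ W → Collide ψ W'
Collide-mono W⊆W' φ⇒ψ c with collision c
... | u , v , u∈ , v∈ , u≢v , eq = collide (W⊆W' u∈) (W⊆W' v∈) u≢v (φ⇒ψ eq)

collide? : ∀ {N m} (φ : Fin N → Fin m) W → Dec (Collide φ W)
collide? φ W = Any.any? (λ u → Any.any? (λ v → ¬? (u ≟ v) ×-dec (φ u ≟ φ v)) W) W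

-- Approximators for monotone functions of the edges of a graph on the vertex set
-- Fin k × Fin Q.  A positive test picks one vertex in each of the k blocks and
-- makes them a clique; a negative test is the complete multipartite graph of a
-- colouring with Q colours.
module Approximation (k Q ℓ : ℕ) where

  N B : ℕ
  N = k * Q
  B = (ℓ + ℓ) * (ℓ + ℓ)

  Vertex Pick Colouring : Set
  Vertex    = Fin N
  Pick      = Fin k → Fin Q
  Colouring = Vertex → Fin Q

  block : Vertex → Fin k
  block = quotient Q

  slot : Vertex → Fin Q
  slot = remainder {k} Q

  _∋_ : Pick → Vertex → Set
  f ∋ v = f (block v) ≡ slot v

  _∈W?_ : (v : Vertex) (W : List Vertex) → Dec (v ∈ W)
  _∈W?_ = _∈?_ _≟_

  -- As a clause, a partition is the disjunction of all edges inside its parts. `support` contains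
  -- every vertex of a nontrivial part, so a branching may enumerate pairs from this short list
  -- instead of all pairs of vertices.
  record Partition : Set where
    field
      parts     : ℕ
      part      : Vertex → Fin parts
      support   : List Vertex
      supported : ∀ {u v} → u ≢ v → part u ≡ part v → u ∈ support
  open Partition

  mergeParts : (p : Partition) (u v : Vertex) → part p u ≢ part p v → Partition
  mergeParts p u v u≢v = record
    { parts     = pred (parts p)
    ; part      = mergeFin u≢v ∘ part p
    ; support   = u ∷ v ∷ support p
    ; supported = sup
    }
    where
    sup : ∀ {w w'} → w ≢ w' → mergeFin u≢v (part p w) ≡ mergeFin u≢v (part p w') → w ∈ u ∷ v ∷ support p
    sup {w} {w'} w≢w' eq with mergeFin-kernel u≢v eq | w ≟ u | w ≟ v
    ... | _               | yes w≡u | _       = here w≡u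
    ... | _               | _       | yes w≡v = there (here w≡v)
    ... | inj₁ eq'        | no  _   | no  _   = there (there (supported p w≢w' eq'))
    ... | inj₂ (inj₁ eq') | no  w≢u | no  _   = there (there (supported p w≢u eq'))
    ... | inj₂ (inj₂ eq') | no  _   | no  w≢v = there (there (supported p w≢v eq'))

  -- A subcube of picks together with the term `members`. By `free-injective` no two blocks share a
  -- parameter, so fixing one parameter fixes one block only; by `fixed∈members` the vertex chosen
  -- in a fixed block already belongs to the term.
  record Box : Set where
    field
      dims           : ℕ
      coord          : Fin k → Fin dims ⊎ Fin Q
      members        : List Vertex
      free-injective : ∀ {i j a} → coord i ≡ inj₁ a → coord j ≡ inj₁ a → i ≡ j
      fixed∈members  : ∀ {i x} → coord i ≡ inj₂ x → combine i x ∈ members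
  open Box

  -- Only the block of `w` is fixed, but both `u` and `v` become members: the term has to contain
  -- the whole edge to cross the clause.
  fixCoord : (b : Box) (w u v : Vertex) → w ∈ u ∷ v ∷ [] → (a : Fin (dims b)) → coord b (block w) ≡ inj₁ a → Box
  fixCoord b w u v w∈ a free = record
    { dims           = pred (dims b)
    ; coord          = λ i → coord' (coord b i)
    ; members        = u ∷ v ∷ members b
    ; free-injective = λ {i} {j} eq eq' → inj (coord b i) (coord b j) refl refl eq eq'
    ; fixed∈members  = λ {i} eq → fix (coord b i) refl eq
    }
    where
    coord' : Fin (dims b) ⊎ Fin Q → Fin (pred (dims b)) ⊎ Fin Q
    coord' = [ fixFin a (slot w) , inj₂ ]′
    inj : ∀ {i j c} s s' → coord b i ≡ s → coord b j ≡ s' → coord' s ≡ inj₁ c → coord' s' ≡ inj₁ c → i ≡ j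
    inj (inj₁ d) (inj₁ d') p p' eq eq' =
      free-injective b p (trans p' (cong inj₁ (sym (fixFin-injective a (slot w) eq eq'))))
    fix : ∀ {i x} s → coord b i ≡ s → coord' s ≡ inj₂ x → combine i x ∈ u ∷ v ∷ members b
    fix {i} {x} (inj₁ d) p eq with fixFin-constant a (slot w) eq
    ... | refl , refl = subst (_∈ u ∷ v ∷ members b)
      (trans (sym (combine-remQuot {k} Q w)) (cong (λ j → combine j (slot w)) (free-injective b free p)))
      (∈-++⁺ˡ w∈)
    fix (inj₂ y) p refl = there (there (fixed∈members b p))

  Term Clause : Set
  Term   = Σ (List Vertex) λ W → length W ≤ ℓ + ℓ
  Clause = Σ Partition λ p → length (support p) ≤ ℓ + ℓ

  Cross : List Vertex → Partition → Set
  Cross W p = Collide (part p) W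

  -- Every branching adds two vertices, so reserving two places for each branching still allowed
  -- keeps all terms and supports within `ℓ + ℓ`.
  Room : ℕ → List Vertex → Set
  Room e W = length W + (e + e) ≤ ℓ + ℓ

  room-step : ∀ {e u v W} → Room (suc e) W → Room e (u ∷ v ∷ W)
  room-step {e} {u} {v} {W} = subst (_≤ ℓ + ℓ) (shift (length W) e)
    where
    shift : ∀ a e → a + (suc e + suc e) ≡ suc (suc (a + (e + e)))
    shift = solve-∀

  NegState PosState : ℕ → Set
  NegState e = Σ Partition λ p → parts p ≤ (N ∸ ℓ) + e × Room e (support p)
  PosState e = Σ Box λ b → dims b ≤ (k ∸ ℓ) + e × Room e (members b)

  dims-step : ∀ {m} β e → m ≤ β + suc e → pred m ≤ β + e
  dims-step β e m≤ = ≤-trans (pred-mono-≤ m≤) (≤-reflexive (cong pred (+-suc β e)))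

  pairwise : {e : ℕ} {S : ℕ → Set} → (Vertex → Vertex → List (S e)) → List Vertex → List (S e)
  pairwise f W = concatMap (uncurry f) (cartesianProduct W W)

  length-pairwise : {e : ℕ} {S : ℕ → Set} (f : Vertex → Vertex → List (S e)) (W : List Vertex) →
    (∀ u v → length (f u v) ≤ 1) → length W ≤ ℓ + ℓ → length (pairwise {S = S} f W) ≤ B
  length-pairwise f W f≤1 W≤ =
    ≤-trans (length-concatMap-≤ (uncurry f) 1 (cartesianProduct W W) (uncurry f≤1))
      (≤-trans (≤-reflexive (trans (*-identityʳ _) (length-cartesianProduct W W))) (*-mono-≤ W≤ W≤))

  mergeBranch : ∀ {e} → NegState (suc e) → Vertex → Vertex → List (NegState e)
  mergeBranch {e} (p , p≤ , room) u v with part p u ≟ part p v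
  ... | yes _  = []
  ... | no u≢v = (mergeParts p u v u≢v , dims-step (N ∸ ℓ) e p≤ , room-step {e} {u} {v} {support p} room) ∷ []

  _respects_ : Colouring → Partition → Set
  χ respects p = χ ⊑ (parts p , inj₁ ∘ part p)

  mergeBranching : Branching Term Colouring B
  mergeBranching = record
    { State  = NegState
    ; Hit    = λ T S → Cross (proj₁ T) (proj₁ S)
    ; hit?   = λ T S → collide? (part (proj₁ S)) (proj₁ T)
    ; branch = λ T S → pairwise {S = NegState} (mergeBranch S) (proj₁ T)
    ; Fits   = λ χ S → χ respects proj₁ S
    ; Meets  = λ χ T → Collide χ (proj₁ T)
    ; branch-length = λ T S → length-pairwise {S = NegState} (mergeBranch S) (proj₁ T) (short S) (proj₂ T)
    ; branch-fits   = fits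
    ; branch-hits   = hits
    ; branch-keeps  = λ T T' S h → All-concatMap (uncurry (mergeBranch S)) (cartesianProduct (proj₁ T) (proj₁ T))
                                    (λ {(u , v)} _ → keeps T' S h u v)
    }
    where
    short : ∀ {e} (S : NegState (suc e)) u v → length (mergeBranch S u v) ≤ 1
    short (p , _) u v with part p u ≟ part p v
    ... | yes _ = z≤n
    ... | no  _ = ≤-refl
    fit : ∀ {e} χ (S : NegState (suc e)) u v → part (proj₁ S) u ≢ part (proj₁ S) v → χ respects proj₁ S →
      χ u ≡ χ v → Any (λ S' → χ respects proj₁ S') (mergeBranch S u v)
    fit χ (p , _) u v u≢v (g , eq) χu≡χv with part p u ≟ part p v
    ... | yes u≡v  = contradiction u≡v u≢v
    ... | no  u≢v' with mergeFin-factor u≢v' g (trans (sym (eq u)) (trans χu≡χv (eq v)))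
    ...   | g' , eq' = here (g' , λ w → trans (eq w) (eq' (part p w)))
    fits : ∀ {e} χ (T : Term) (S : NegState (suc e)) → ¬ Cross (proj₁ T) (proj₁ S) → χ respects proj₁ S →
      Collide χ (proj₁ T) → Any (λ S' → χ respects proj₁ S') (pairwise {S = NegState} (mergeBranch S) (proj₁ T))
    fits χ T S ¬h fit-S c with collision c
    ... | u , v , u∈ , v∈ , u≢v , χu≡χv =
      ∈-Any-concatMap (uncurry (mergeBranch S)) (∈-cartesianProduct⁺ u∈ v∈)
        (fit χ S u v (λ eq → ¬h (collide u∈ v∈ u≢v eq)) fit-S χu≡χv)
    hit : ∀ {e} {W} (S : NegState (suc e)) u v → u ∈ W → v ∈ W →
      All (λ S' → Cross W (proj₁ S')) (mergeBranch S u v)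
    hit (p , _) u v u∈ v∈ with part p u ≟ part p v
    ... | yes _  = []
    ... | no u≢v = collide u∈ v∈ (λ { refl → u≢v refl }) (mergeFin-joins u≢v) ∷ []
    hits : ∀ {e} (T : Term) (S : NegState (suc e)) →
      All (λ S' → Cross (proj₁ T) (proj₁ S')) (pairwise {S = NegState} (mergeBranch S) (proj₁ T))
    hits (W , _) S = All-concatMap (uncurry (mergeBranch S)) (cartesianProduct W W)
      λ {(u , v)} uv∈ → let u∈ , v∈ = ∈-cartesianProduct⁻ W W uv∈ in hit S u v u∈ v∈
    keeps : ∀ {e} (T : Term) (S : NegState (suc e)) → Cross (proj₁ T) (proj₁ S) → ∀ u v →
      All (λ S' → Cross (proj₁ T) (proj₁ S')) (mergeBranch S u v)
    keeps T (p , _) h u v with part p u ≟ part p v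
    ... | yes _  = []
    ... | no u≢v = Collide-mono id (cong (mergeFin u≢v)) h ∷ []

  pickAt : ∀ {e} (S : PosState (suc e)) (w u v : Vertex) → w ∈ u ∷ v ∷ [] →
    ∀ s → coord (proj₁ S) (block w) ≡ s → List (PosState e)
  pickAt _ w u v w∈ (inj₂ _) _ = []
  pickAt {e} (b , b≤ , room) w u v w∈ (inj₁ a) eq =
    (fixCoord b w u v w∈ a eq , dims-step (k ∸ ℓ) e b≤ , room-step {e} {u} {v} {members b} room) ∷ []

  pickBranch : ∀ {e} → PosState (suc e) → (w u v : Vertex) → w ∈ u ∷ v ∷ [] → List (PosState e)
  pickBranch S w u v w∈ = pickAt S w u v w∈ _ refl

  -- While the clause is not hit, a pair inside a part cannot consist of two members. The block of
  -- an end that is not yet a member is fixed, so each branching really loses a dimension.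
  cliqueBranch : ∀ {e} → Partition → PosState (suc e) → Vertex → Vertex → List (PosState e)
  cliqueBranch p S u v with u ≟ v | part p u ≟ part p v | u ∈W? members (proj₁ S)
  ... | no _ | yes _ | no  _ = pickBranch S u u v (here refl)
  ... | no _ | yes _ | yes _ = pickBranch S v u v (there (here refl))
  ... | _    | _     | _     = []

  _within_ : Pick → Box → Set
  f within b = f ⊑ (dims b , coord b) × All (f ∋_) (members b)

  _meets_ : Pick → Partition → Set
  f meets p = ∃₂ λ u v → f ∋ u × f ∋ v × u ≢ v × part p u ≡ part p v

  pickAt-length : ∀ {e} (S : PosState (suc e)) w u v w∈ s eq → length (pickAt S w u v w∈ s eq) ≤ 1
  pickAt-length S w u v w∈ (inj₂ _) eq = z≤n
  pickAt-length S w u v w∈ (inj₁ _) eq = ≤-refl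

  pickAt-within : ∀ {e} f (S : PosState (suc e)) w u v w∈ s eq → ¬ (w ∈ members (proj₁ S)) →
    f within proj₁ S → f ∋ u → f ∋ v → Any (λ S' → f within proj₁ S') (pickAt S w u v w∈ s eq)
  pickAt-within f (b , _) w u v w∈ (inj₂ x) ceq w∉ ((g , eq) , all) fu fv = contradiction
    (subst (_∈ members b) (trans (cong (combine (block w)) x≡slot) (combine-remQuot {k} Q w)) (fixed∈members b ceq)) w∉
    where
    x≡slot : x ≡ slot w
    x≡slot = trans (sym (cong [ g , id ] ceq)) (trans (sym (eq (block w))) (All.lookup {P = f ∋_} (fu ∷ fv ∷ []) w∈))
  pickAt-within f (b , _) w u v w∈ (inj₁ a) ceq w∉ ((g , eq) , all) fu fv
    with fixFin-factor a (slot w) g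
           (trans (sym (trans (eq (block w)) (cong [ g , id ] ceq))) (All.lookup {P = f ∋_} (fu ∷ fv ∷ []) w∈))
  ... | g' , eq' = here ((g' , λ i → trans (eq i) (split (coord b i))) , fu ∷ fv ∷ all)
    where
    split : ∀ s → [ g , id ] s ≡ [ g' , id ] ([ fixFin a (slot w) , inj₂ ]′ s)
    split (inj₁ c) = eq' c
    split (inj₂ y) = refl

  pickAt-members : ∀ {e} {P : List Vertex → Set} (S : PosState (suc e)) w u v w∈ s eq →
    P (u ∷ v ∷ members (proj₁ S)) → All (λ S' → P (members (proj₁ S'))) (pickAt S w u v w∈ s eq)
  pickAt-members S w u v w∈ (inj₂ _) eq p = []
  pickAt-members S w u v w∈ (inj₁ _) eq p = p ∷ []

  cliqueBranching : Branching Clause Pick B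
  cliqueBranching = record
    { State  = PosState
    ; Hit    = λ K S → Cross (members (proj₁ S)) (proj₁ K)
    ; hit?   = λ K S → collide? (part (proj₁ K)) (members (proj₁ S))
    ; branch = λ K S → pairwise {S = PosState} (cliqueBranch (proj₁ K) S) (support (proj₁ K))
    ; Fits   = λ f S → f within proj₁ S
    ; Meets  = λ f K → f meets proj₁ K
    ; branch-length = λ K S → length-pairwise {S = PosState} (cliqueBranch (proj₁ K) S) (support (proj₁ K))
                                (short (proj₁ K) S) (proj₂ K)
    ; branch-fits   = λ f K S → fits f (proj₁ K) S
    ; branch-hits   = λ K S → All-concatMap (uncurry (cliqueBranch (proj₁ K) S)) (cartesianProduct (support (proj₁ K)) (support (proj₁ K))) (λ {(u , v)} _ → hits (proj₁ K) S u v)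
    ; branch-keeps  = λ K K' S h → All-concatMap (uncurry (cliqueBranch (proj₁ K) S)) (cartesianProduct (support (proj₁ K)) (support (proj₁ K)))
                                     (λ {(u , v)} _ → keeps (proj₁ K) (proj₁ K') S h u v)
    }
    where
    short : ∀ {e} p (S : PosState (suc e)) u v → length (cliqueBranch p S u v) ≤ 1
    short p S u v with u ≟ v | part p u ≟ part p v | u ∈W? members (proj₁ S)
    ... | no _  | yes _ | no  _ = pickAt-length S u u v _ _ refl
    ... | no _  | yes _ | yes _ = pickAt-length S v u v _ _ refl
    ... | yes _ | _     | _     = z≤n
    ... | no _  | no _  | _     = z≤n
    fit : ∀ {e} f p (S : PosState (suc e)) u v → ¬ Cross (members (proj₁ S)) p → f within proj₁ S →
      f ∋ u → f ∋ v → u ≢ v → part p u ≡ part p v → Any (λ S' → f within proj₁ S') (cliqueBranch p S u v)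
    fit f p S u v ¬h inside fu fv u≢v eq with u ≟ v | part p u ≟ part p v | u ∈W? members (proj₁ S)
    ... | yes u≡v | _      | _      = contradiction u≡v u≢v
    ... | no  _   | no neq | _      = contradiction eq neq
    ... | no  _   | yes _  | no u∉  = pickAt-within f S u u v _ _ refl u∉ inside fu fv
    ... | no  _   | yes _  | yes u∈ = pickAt-within f S v u v _ _ refl (λ v∈ → ¬h (collide u∈ v∈ u≢v eq)) inside fu fv
    fits : ∀ {e} f p (S : PosState (suc e)) → ¬ Cross (members (proj₁ S)) p → f within proj₁ S → f meets p →
      Any (λ S' → f within proj₁ S') (pairwise {S = PosState} (cliqueBranch p S) (support p))
    fits f p S ¬h inside (u , v , fu , fv , u≢v , eq) =
      ∈-Any-concatMap (uncurry (cliqueBranch p S))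
        (∈-cartesianProduct⁺ (supported p u≢v eq) (supported p (u≢v ∘ sym) (sym eq)))
        (fit f p S u v ¬h inside fu fv u≢v eq)
    hits : ∀ {e} p (S : PosState (suc e)) u v → All (λ S' → Cross (members (proj₁ S')) p) (cliqueBranch p S u v)
    hits p S u v with u ≟ v | part p u ≟ part p v | u ∈W? members (proj₁ S)
    ... | yes _   | _      | _     = []
    ... | no  _   | no _   | _     = []
    ... | no  u≢v | yes eq | no  _ = pickAt-members {P = λ W → Cross W p} S u u v _ _ refl
                                       (collide (here refl) (there (here refl)) u≢v eq)
    ... | no  u≢v | yes eq | yes _ = pickAt-members {P = λ W → Cross W p} S v u v _ _ refl
                                       (collide (here refl) (there (here refl)) u≢v eq)
    keeps : ∀ {e} p p' (S : PosState (suc e)) → Cross (members (proj₁ S)) p' → ∀ u v →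
      All (λ S' → Cross (members (proj₁ S')) p') (cliqueBranch p S u v)
    keeps p p' S h u v with u ≟ v | part p u ≟ part p v | u ∈W? members (proj₁ S)
    ... | yes _   | _      | _     = []
    ... | no  _   | no _   | _     = []
    ... | no  u≢v | yes eq | no  _ = pickAt-members {P = λ W → Cross W p'} S u u v _ _ refl (Collide-mono (there ∘ there) id h)
    ... | no  u≢v | yes eq | yes _ = pickAt-members {P = λ W → Cross W p'} S v u v _ _ refl (Collide-mono (there ∘ there) id h)

  trivial : Partition
  trivial = record { parts = N ; part = id ; support = [] ; supported = λ u≢v u≡v → contradiction u≡v u≢v }

  fullBox : Box
  fullBox = record
    { dims = k ; coord = inj₁ ; members = []
    ; free-injective = λ eq eq' → inj₁-injective (trans eq (sym eq')) ; fixed∈members = λ () }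

  start⁻ : NegState ℓ
  start⁻ = trivial , ≤-trans (m≤n+m∸n N ℓ) (≤-reflexive (+-comm ℓ (N ∸ ℓ))) , ≤-refl

  start⁺ : PosState ℓ
  start⁺ = fullBox , ≤-trans (m≤n+m∸n k ℓ) (≤-reflexive (+-comm ℓ (k ∸ ℓ))) , ≤-refl

  toTerm : Σ ℕ PosState → Term
  toTerm (e , b , _ , room) = members b , ≤-trans (m≤m+n _ (e + e)) room

  toClause : Σ ℕ NegState → Clause
  toClause (e , p , _ , room) = p , ≤-trans (m≤m+n _ (e + e)) room

  -- Approximators and their gates

  module Clique = Branching cliqueBranching
  module Merge  = Branching mergeBranching

  record Approximator : Set where
    field
      terms    : List Term
      clauses  : List Clause
      crossing : ∀ {T K} → T ∈ terms → K ∈ clauses → Cross (proj₁ T) (proj₁ K)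
  open Approximator

  Accepts : Pick → Approximator → Set
  Accepts f a = Any (λ T → All (f ∋_) (proj₁ T)) (terms a)

  Rejects : Colouring → Approximator → Set
  Rejects χ a = Any (λ K → χ respects proj₁ K) (clauses a)

  constᴬ : Bool → Approximator
  constᴬ true  = record { terms = ([] , z≤n) ∷ [] ; clauses = [] ; crossing = λ _ () }
  -- The partition into singletons is a disjunction of no edges, and every colouring respects it.
  constᴬ false = record { terms = [] ; clauses = (trivial , z≤n) ∷ [] ; crossing = λ () }

  errors∧ : Approximator → Approximator → List (PosState 0)
  errors∧ a b = Clique.errors start⁺ (clauses a ++ clauses b)

  errors∨ : Approximator → Approximator → List (NegState 0)
  errors∨ a b = Merge.errors start⁻ (terms a ++ terms b)

  -- For a conjunction the CNF is exact, and only the DNF is rebuilt, from that CNF; for a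
  -- disjunction the roles are exchanged. Hence conjunctions lose picks but no colourings, and
  -- disjunctions lose colourings but no picks.
  _∧ᴬ_ _∨ᴬ_ : Approximator → Approximator → Approximator
  a ∧ᴬ b = record
    { terms    = map toTerm (Clique.leaves start⁺ (clauses a ++ clauses b))
    ; clauses  = clauses a ++ clauses b
    ; crossing = λ T∈ K∈ → case ∈-map⁻ toTerm T∈ of λ { (S , S∈ , refl) →
        All.lookup (All.lookup (Clique.leaves-hit start⁺ (clauses a ++ clauses b)) K∈) S∈ }
    }
  a ∨ᴬ b = record
    { terms    = terms a ++ terms b
    ; clauses  = map toClause (Merge.leaves start⁻ (terms a ++ terms b))
    ; crossing = λ T∈ K∈ → case ∈-map⁻ toClause K∈ of λ { (S , S∈ , refl) →
        All.lookup (All.lookup (Merge.leaves-hit start⁻ (terms a ++ terms b)) T∈) S∈ }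
    }

  respects⇒≡ : ∀ {χ p u v} → χ respects p → part p u ≡ part p v → χ u ≡ χ v
  respects⇒≡ {u = u} {v} (g , eq) uv = trans (eq u) (trans (cong g uv) (sym (eq v)))

  -- Acceptance speaks of terms while the branching consumes clauses; `crossing` translates, since
  -- the accepted term supplies an edge inside a part of each clause.
  accepts⇒meets : ∀ {f} a → Accepts f a → All (λ K → f meets proj₁ K) (clauses a)
  accepts⇒meets a acc with find acc
  ... | T , T∈ , f∋T = All.tabulate λ K∈ → case collision (crossing a T∈ K∈) of λ
    { (u , v , u∈ , v∈ , u≢v , eq) → u , v , All.lookup f∋T u∈ , All.lookup f∋T v∈ , u≢v , eq }

  rejects⇒collide : ∀ {χ} a → Rejects χ a → All (λ T → Collide χ (proj₁ T)) (terms a)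
  rejects⇒collide {χ} a rej with find rej
  ... | K , K∈ , χK = All.tabulate λ T∈ → Collide-mono id (respects⇒≡ {χ} {proj₁ K} χK) (crossing a T∈ K∈)

  accepts-∧ : ∀ {f} a b → Accepts f a → Accepts f b →
    Any (λ S → f within proj₁ S) (errors∧ a b) ⊎ Accepts f (a ∧ᴬ b)
  accepts-∧ {f} a b fa fb = map₂ (Anyₚ.map⁺ ∘ Any.map (λ {S} → proj₂))
    (Clique.fits-somewhere f start⁺ (clauses a ++ clauses b) ((f , λ _ → refl) , [])
      (Allₚ.++⁺ (accepts⇒meets {f} a fa) (accepts⇒meets {f} b fb)))

  rejects-∨ : ∀ {χ} a b → Rejects χ a → Rejects χ b →
    Any (λ S → χ respects proj₁ S) (errors∨ a b) ⊎ Rejects χ (a ∨ᴬ b)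
  rejects-∨ {χ} a b χa χb = map₂ Anyₚ.map⁺
    (Merge.fits-somewhere χ start⁻ (terms a ++ terms b) (χ , λ _ → refl)
      (Allₚ.++⁺ (rejects⇒collide a χa) (rejects⇒collide b χb)))

  accepts-∨ : ∀ {f} a b → Accepts f a ⊎ Accepts f b → Accepts f (a ∨ᴬ b)
  accepts-∨ a b = [ Anyₚ.++⁺ˡ , Anyₚ.++⁺ʳ (terms a) ]

  rejects-∧ : ∀ {χ} a b → Rejects χ a ⊎ Rejects χ b → Rejects χ (a ∧ᴬ b)
  rejects-∧ a b = [ Anyₚ.++⁺ˡ , Anyₚ.++⁺ʳ (clauses a) ]

  -- Errors of a whole program

  module Program {X : Set} (input : X → Approximator) where

    gateᴬ : ∀ {l} → (Fin l → Approximator) → Gate X l → Approximator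
    gateᴬ A (const b)   = constᴬ b
    gateᴬ A (copy i)    = A i
    gateᴬ A (and i j)   = A i ∧ᴬ A j
    gateᴬ A (or i j)    = A i ∨ᴬ A j
    gateᴬ A (sel x i j) = A j ∧ᴬ (input x ∨ᴬ A i)

    progᴬ : ∀ {l} → Prog X l → Fin l → Approximator
    progᴬ (g ∷ P) zero    = gateᴬ (progᴬ P) g
    progᴬ (g ∷ P) (suc i) = progᴬ P i

    gate⁺ : ∀ {l} → (Fin l → Approximator) → Gate X l → List (PosState 0)
    gate⁺ A (and i j)   = errors∧ (A i) (A j)
    -- The inner disjunction loses no pick, so this gate too pays for a single conversion on each
    -- side.
    gate⁺ A (sel x i j) = errors∧ (A j) (input x ∨ᴬ A i)
    gate⁺ A _           = []

    gate⁻ : ∀ {l} → (Fin l → Approximator) → Gate X l → List (NegState 0)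
    gate⁻ A (or i j)    = errors∨ (A i) (A j)
    gate⁻ A (sel x i j) = errors∨ (input x) (A i)
    gate⁻ A _           = []

    errors⁺ : ∀ {l} → Prog X l → List (PosState 0)
    errors⁺ []      = []
    errors⁺ (g ∷ P) = gate⁺ (progᴬ P) g ++ errors⁺ P

    errors⁻ : ∀ {l} → Prog X l → List (NegState 0)
    errors⁻ []      = []
    errors⁻ (g ∷ P) = gate⁻ (progᴬ P) g ++ errors⁻ P

    module _ .{{_ : NonZero B}} where

      gate⁺-length : ∀ {l} A (g : Gate X l) → length (gate⁺ A g) ≤ B ^ ℓ
      gate⁺-length A (const b)   = z≤n
      gate⁺-length A (copy i)    = z≤n
      gate⁺-length A (and i j)   = Clique.errors-length start⁺ _
      gate⁺-length A (or i j)    = z≤n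
      gate⁺-length A (sel x i j) = Clique.errors-length start⁺ _

      gate⁻-length : ∀ {l} A (g : Gate X l) → length (gate⁻ A g) ≤ B ^ ℓ
      gate⁻-length A (const b)   = z≤n
      gate⁻-length A (copy i)    = z≤n
      gate⁻-length A (and i j)   = z≤n
      gate⁻-length A (or i j)    = Merge.errors-length start⁻ _
      gate⁻-length A (sel x i j) = Merge.errors-length start⁻ _

      errors⁺-length : ∀ {l} (P : Prog X l) → length (errors⁺ P) ≤ l * B ^ ℓ
      errors⁺-length []      = z≤n
      errors⁺-length (g ∷ P) = ≤-trans (≤-reflexive (length-++ (gate⁺ (progᴬ P) g)))
        (+-mono-≤ (gate⁺-length (progᴬ P) g) (errors⁺-length P))

      errors⁻-length : ∀ {l} (P : Prog X l) → length (errors⁻ P) ≤ l * B ^ ℓ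
      errors⁻-length []      = z≤n
      errors⁻-length (g ∷ P) = ≤-trans (≤-reflexive (length-++ (gate⁻ (progᴬ P) g)))
        (+-mono-≤ (gate⁻-length (progᴬ P) g) (errors⁻-length P))

    module Positive (f : Pick) (a : X → Bool) (input-sound : ∀ x → a x ≡ true → Accepts f (input x)) where

      Err⁺ : List (PosState 0) → Set
      Err⁺ = Any (λ S → f within proj₁ S)

      gate-sound : ∀ {l} A (val : Fin l → Bool) → (∀ i → val i ≡ true → Accepts f (A i)) → ∀ g →
        Err⁺ (gate⁺ A g) ⊎ (gateVal a val g ≡ true → Accepts f (gateᴬ A g))
      gate-sound A val ih (const true)  = inj₂ λ _ → here []
      gate-sound A val ih (const false) = inj₂ λ ()
      gate-sound A val ih (copy i)      = inj₂ (ih i)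
      gate-sound A val ih (and i j) with val i in eqi | val j in eqj
      ... | false | _     = inj₂ λ ()
      ... | true  | false = inj₂ λ ()
      ... | true  | true  = map₂ (λ acc _ → acc) (accepts-∧ (A i) (A j) (ih i eqi) (ih j eqj))
      gate-sound A val ih (or i j) with val i in eqi
      ... | true  = inj₂ λ _ → accepts-∨ {f} (A i) (A j) (inj₁ (ih i eqi))
      ... | false = inj₂ λ eqj → accepts-∨ {f} (A i) (A j) (inj₂ (ih j eqj))
      gate-sound A val ih (sel x i j) with val j in eqj | a x in eqx | val i in eqi
      ... | false | _     | _     = inj₂ λ ()
      ... | true  | false | false = inj₂ λ ()
      ... | true  | true  | _     = map₂ (λ acc _ → acc) (accepts-∧ (A j) (input x ∨ᴬ A i) (ih j eqj)
                                      (accepts-∨ {f} (input x) (A i) (inj₁ (input-sound x eqx))))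
      ... | true  | false | true  = map₂ (λ acc _ → acc) (accepts-∧ (A j) (input x ∨ᴬ A i) (ih j eqj)
                                      (accepts-∨ {f} (input x) (A i) (inj₂ (ih i eqi))))

      -- The error list does not depend on the test, so a pick outside it is treated correctly at
      -- all gates simultaneously, as the induction requires.
      sound : ∀ {l} (P : Prog X l) → Err⁺ (errors⁺ P) ⊎ (∀ i → progVal P a i ≡ true → Accepts f (progᴬ P i))
      sound []      = inj₂ λ ()
      sound (g ∷ P) with sound P
      ... | inj₁ err = inj₁ (Anyₚ.++⁺ʳ (gate⁺ (progᴬ P) g) err)
      ... | inj₂ ih with gate-sound (progᴬ P) (progVal P a) ih g
      ...   | inj₁ err = inj₁ (Anyₚ.++⁺ˡ err)
      ...   | inj₂ top = inj₂ λ { zero → top ; (suc i) → ih i }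

    module Negative (χ : Colouring) (a : X → Bool) (input-sound : ∀ x → a x ≡ false → Rejects χ (input x)) where

      Err⁻ : List (NegState 0) → Set
      Err⁻ = Any (λ S → χ respects proj₁ S)

      gate-sound : ∀ {l} A (val : Fin l → Bool) → (∀ i → val i ≡ false → Rejects χ (A i)) → ∀ g →
        Err⁻ (gate⁻ A g) ⊎ (gateVal a val g ≡ false → Rejects χ (gateᴬ A g))
      gate-sound A val ih (const false) = inj₂ λ _ → here (χ , λ _ → refl)
      gate-sound A val ih (const true)  = inj₂ λ ()
      gate-sound A val ih (copy i)      = inj₂ (ih i)
      gate-sound A val ih (and i j) with val i in eqi
      ... | false = inj₂ λ _ → rejects-∧ (A i) (A j) (inj₁ (ih i eqi))
      ... | true  = inj₂ λ eqj → rejects-∧ (A i) (A j) (inj₂ (ih j eqj))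
      gate-sound A val ih (or i j) with val i in eqi | val j in eqj
      ... | true  | _     = inj₂ λ ()
      ... | false | true  = inj₂ λ ()
      ... | false | false = map₂ (λ rej _ → rej) (rejects-∨ (A i) (A j) (ih i eqi) (ih j eqj))
      gate-sound A val ih (sel x i j) with val j in eqj | a x in eqx | val i in eqi
      ... | false | _     | _     = inj₂ λ _ → rejects-∧ (A j) (input x ∨ᴬ A i) (inj₁ (ih j eqj))
      ... | true  | true  | _     = inj₂ λ ()
      ... | true  | false | true  = inj₂ λ ()
      ... | true  | false | false = map₂ (λ rej _ → rejects-∧ (A j) (input x ∨ᴬ A i) (inj₂ rej))
                                      (rejects-∨ (input x) (A i) (input-sound x eqx) (ih i eqi))

      sound : ∀ {l} (P : Prog X l) → Err⁻ (errors⁻ P) ⊎ (∀ i → progVal P a i ≡ false → Rejects χ (progᴬ P i))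
      sound []      = inj₂ λ ()
      sound (g ∷ P) with sound P
      ... | inj₁ err = inj₁ (Anyₚ.++⁺ʳ (gate⁻ (progᴬ P) g) err)
      ... | inj₂ ih with gate-sound (progᴬ P) (progVal P a) ih g
      ...   | inj₁ err = inj₁ (Anyₚ.++⁺ˡ err)
      ...   | inj₂ top = inj₂ λ { zero → top ; (suc i) → ih i }

-- Arithmetic of the union bounds

^-distribʳ-* : ∀ a b e → (a * b) ^ e ≡ a ^ e * b ^ e
^-distribʳ-* a b zero    = refl
^-distribʳ-* a b (suc e) = trans (cong (a * b *_) (^-distribʳ-* a b e)) (shuffle a b (a ^ e) (b ^ e))
  where
  shuffle : ∀ a b x y → a * b * (x * y) ≡ a * x * (b * y)
  shuffle = solve-∀

module _ (L E B D : ℕ) .{{_ : NonZero B}} where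

  private
    instance
      4B≢0 : NonZero (4 * B)
      4B≢0 = m*n≢0 4 B

  -- Each error covers a (4 B) ^ -ℓ fraction of the picks and a gate has at most B ^ ℓ errors, so 4
  -- ^ ℓ ≤ L, which is weakened to the base 2 of the final bound.
  count⁺ : ∀ ℓ → E ≤ L * B ^ ℓ → (4 * B) ^ (D + ℓ) ≤ E * (4 * B) ^ D → 2 ^ ℓ ≤ L
  count⁺ ℓ E≤ cover = ≤-trans (^-monoˡ-≤ ℓ {2} {4} (s≤s (s≤s z≤n))) (*-cancelʳ-≤ (4 ^ ℓ) L (B ^ ℓ) {{m^n≢0 B ℓ}} (begin
    4 ^ ℓ * B ^ ℓ  ≡⟨ ^-distribʳ-* 4 B ℓ ⟨
    (4 * B) ^ ℓ    ≤⟨ *-cancelʳ-≤ ((4 * B) ^ ℓ) E ((4 * B) ^ D) {{m^n≢0 (4 * B) D}}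
                        (≤-trans (≤-reflexive (trans (*-comm ((4 * B) ^ ℓ) _) (sym (^-distribˡ-+-* (4 * B) D ℓ)))) cover) ⟩
    E              ≤⟨ E≤ ⟩
    L * B ^ ℓ      ∎))
    where open ≤-Reasoning

  -- The B additional subcubes of codimension one contain at most B / (4 B) = 1 / 4 of the
  -- colourings. The errors must cover the other three quarters, and 3 · 4 ^ e is still at least 2 ^
  -- (e + 1).
  count⁻ : ∀ e → E ≤ L * B ^ suc e →
    (4 * B) ^ (D + suc e) ≤ E * (4 * B) ^ D + B * (4 * B) ^ (D + e) → 2 ^ suc e ≤ L
  count⁻ e E≤ cover = ≤-trans (*-mono-≤ {2} {3} (s≤s (s≤s z≤n)) (^-monoˡ-≤ e {2} {4} (s≤s (s≤s z≤n))))
    (*-cancelʳ-≤ (3 * 4 ^ e) L (B ^ suc e) {{m^n≢0 B (suc e)}} (begin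
      3 * 4 ^ e * B ^ suc e        ≡⟨ shuffle (4 ^ e) B (B ^ e) ⟩
      3 * B * (4 ^ e * B ^ e)      ≡⟨ cong (3 * B *_) (^-distribʳ-* 4 B e) ⟨
      3 * B * q ^ e                ≤⟨ +-cancelʳ-≤ (B * q ^ e) _ _ step ⟩
      E                            ≤⟨ E≤ ⟩
      L * B ^ suc e                ∎))
    where
    open ≤-Reasoning
    q : ℕ
    q = 4 * B
    shuffle : ∀ x b y → 3 * x * (b * y) ≡ 3 * b * (x * y)
    shuffle = solve-∀
    expand : ∀ b y d → (3 * b * y + b * y) * d ≡ d * (4 * b * y)
    expand = solve-∀
    collect : ∀ E b y d → E * d + b * (d * y) ≡ (E + b * y) * d
    collect = solve-∀
    step : 3 * B * q ^ e + B * q ^ e ≤ E + B * q ^ e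
    step = *-cancelʳ-≤ _ _ (q ^ D) {{m^n≢0 q D}} (begin
      (3 * B * q ^ e + B * q ^ e) * q ^ D ≡⟨ expand B (q ^ e) (q ^ D) ⟩
      q ^ D * q ^ suc e                   ≡⟨ ^-distribˡ-+-* q D (suc e) ⟨
      q ^ (D + suc e)                     ≤⟨ cover ⟩
      E * q ^ D + B * q ^ (D + e)         ≡⟨ cong (λ z → E * q ^ D + B * z) (^-distribˡ-+-* q D e) ⟩
      E * q ^ D + B * (q ^ D * q ^ e)     ≡⟨ collect E B (q ^ e) (q ^ D) ⟩
      (E + B * q ^ e) * q ^ D             ∎)

-- The lower bound for monotone programs on the core

module LowerBound (k Q ℓ' : ℕ) (Q≡4B : Q ≡ 4 * ((suc ℓ' + suc ℓ') * (suc ℓ' + suc ℓ'))) (ℓ≤k : suc ℓ' ≤ k) where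

  open Approximation k Q (suc ℓ')

  module Bound {X : Set} (input : X → Approximator)
    (positive : Pick → X → Bool) (negative : Colouring → X → Bool)
    (input⁺ : ∀ f x → positive f x ≡ true → Accepts f (input x))
    (input⁻ : ∀ χ x → negative χ x ≡ false → Rejects χ (input x)) where

    open Program input
    open Approximator

    private
      ℓ : ℕ
      ℓ = suc ℓ'

      instance
        Q≢0 : NonZero Q
        Q≢0 = subst NonZero (sym Q≡4B) _

    ℓ≤N : ℓ ≤ N
    ℓ≤N = ≤-trans ℓ≤k (m≤m*n k Q)

    box-cube : PosState 0 → Subcube k Q
    box-cube (b , _) = Box.dims b , Box.coord b

    partition-cube : ∀ {e} → NegState e → Subcube N Q
    partition-cube (p , _) = Partition.parts p , inj₁ ∘ Partition.part p

    module _ {l} (P : Prog X (suc l)) where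

      -- Without terms the last approximator accepts nothing, so every pick lies in an error box.
      accepted⇒bound : (∀ f → progVal P (positive f) zero ≡ true) → terms (progᴬ P zero) ≡ [] → 2 ^ ℓ ≤ suc l
      accepted⇒bound accepted no-terms = count⁺ (suc l) (length (errors⁺ P)) B (k ∸ ℓ) ℓ (errors⁺-length P)
        (subst₂ _≤_ (cong₂ _^_ Q≡4B (sym (m∸n+n≡m ℓ≤k))) lhs
          (cover⇒≤ {k} {Q} {(k ∸ ℓ) + 0} (map box-cube (errors⁺ P)) [] (Allₚ.map⁺ (All.universal (λ S → proj₁ (proj₂ S)) (errors⁺ P)))
            ([] {P = (_≤ 0) ∘ proj₁}) covered))
        where
        lhs : length (map box-cube (errors⁺ P)) * Q ^ ((k ∸ ℓ) + 0) + 0 ≡ length (errors⁺ P) * (4 * B) ^ (k ∸ ℓ)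
        lhs = trans (+-identityʳ _) (cong₂ _*_ (length-map box-cube (errors⁺ P)) (cong₂ _^_ Q≡4B (+-identityʳ (k ∸ ℓ))))
        covered : ∀ f → Any (f ⊑_) (map box-cube (errors⁺ P)) ⊎ Any (f ⊑_) []
        covered f with Positive.sound f (positive f) (input⁺ f) P
        ... | inj₁ err = inj₁ (Anyₚ.map⁺ (Any.map proj₁ err))
        ... | inj₂ acc = case subst (Any _) no-terms (acc zero (accepted f)) of λ ()

      -- A colouring outside the errors is rejected by some clause, which `T` crosses, so it repeats
      -- a colour on `T`. Such colourings are covered by the branches of one merging step from the
      -- discrete partition, one for each pair from `T`.
      rejected⇒bound : (∀ χ → progVal P (negative χ) zero ≡ false) → ∀ T → T ∈ terms (progᴬ P zero) → 2 ^ ℓ ≤ suc l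
      rejected⇒bound rejected T T∈ = count⁻ (suc l) (length (errors⁻ P)) B (N ∸ ℓ) ℓ' (errors⁻-length P)
        (≤-trans (subst₂ _≤_ (cong₂ _^_ Q≡4B (sym (m∸n+n≡m ℓ≤N))) rhs
          (cover⇒≤ {N} {Q} {(N ∸ ℓ) + 0} {(N ∸ ℓ) + ℓ'} (map partition-cube (errors⁻ P)) (map partition-cube collisions)
            (Allₚ.map⁺ (All.universal (λ S → proj₁ (proj₂ S)) (errors⁻ P)))
            (Allₚ.map⁺ (All.universal (λ S → proj₁ (proj₂ S)) collisions)) covered))
          (+-monoʳ-≤ _ (*-monoˡ-≤ ((4 * B) ^ ((N ∸ ℓ) + ℓ')) (Merge.branch-length T start⁻))))
        where
        collisions : List (NegState ℓ')
        collisions = Merge.branch T start⁻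
        rhs : length (map partition-cube (errors⁻ P)) * Q ^ ((N ∸ ℓ) + 0) +
              length (map partition-cube collisions) * Q ^ ((N ∸ ℓ) + ℓ') ≡
              length (errors⁻ P) * (4 * B) ^ (N ∸ ℓ) + length collisions * (4 * B) ^ ((N ∸ ℓ) + ℓ')
        rhs = cong₂ _+_
          (cong₂ _*_ (length-map partition-cube (errors⁻ P)) (cong₂ _^_ Q≡4B (+-identityʳ (N ∸ ℓ))))
          (cong₂ _*_ (length-map partition-cube collisions) (cong (_^ ((N ∸ ℓ) + ℓ')) Q≡4B))
        covered : ∀ χ → Any (χ ⊑_) (map partition-cube (errors⁻ P)) ⊎ Any (χ ⊑_) (map partition-cube collisions)
        covered χ with Negative.sound χ (negative χ) (input⁻ χ) P
        ... | inj₁ err = inj₁ (Anyₚ.map⁺ err)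
        ... | inj₂ rej = inj₂ (Anyₚ.map⁺ (Merge.branch-fits χ T start⁻
              (λ c → case collision c of λ { (u , v , _ , _ , u≢v , u≡v) → u≢v u≡v })
              (χ , λ _ → refl)
              (All.lookup (rejects⇒collide (progᴬ P zero) (rej zero (rejected χ))) T∈)))

      size-bound : (∀ f → progVal P (positive f) zero ≡ true) → (∀ χ → progVal P (negative χ) zero ≡ false) →
        2 ^ ℓ ≤ suc l
      size-bound accepted rejected with terms (progᴬ P zero) in eq
      ... | []    = accepted⇒bound accepted eq
      ... | T ∷ _ = rejected⇒bound rejected T (subst (T ∈_) (sym eq) (here refl))

-- Satisfying assignments of A_n are cliques

if-yes : ∀ {a} {X : Set a} {b : Bool} {x y : X} → T b → (if b then x else y) ≡ x
if-yes {b = true} _ = refl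

if-no : ∀ {a} {X : Set a} {b : Bool} {x y : X} → ¬ T b → (if b then x else y) ≡ y
if-no {b = false} _ = refl
if-no {b = true}  h = contradiction _ h

∈-concatMap-allFin : {n : ℕ} {X : Set} (f : Fin n → List X) {x : X} (i : Fin n) → x ∈ f i → x ∈ concatMap f (allFin n)
∈-concatMap-allFin f i x∈ = ∈-concatMap⁺ f (lose (∈-allFin i) x∈)

∈-pairs : ∀ {n} v (u : Fin (toℕ v)) → (v , u) ∈ pairs n
∈-pairs v u = ∈-concatMap-allFin _ v (∈-map⁺ (v ,_) (∈-allFin u))

∈-pairsLt : ∀ {k} {i j : Fin k} → toℕ i < toℕ j → (i , j) ∈ pairsLt k
∈-pairsLt {i = i} {j} i<j = ∈-concatMap-allFin _ i (∈-concatMap-allFin _ j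
  (subst ((i , j) ∈_) (sym (if-yes (<⇒<ᵇ i<j))) (here refl)))

pairsLt-≢ : ∀ k → All (uncurry _≢_) (pairsLt k)
pairsLt-≢ k = All-concatMap _ (allFin k) λ {i} _ → All-concatMap _ (allFin k) λ {j} _ → member i j
  where
  member : ∀ i j → All (uncurry _≢_) (if toℕ i <ᵇ toℕ j then (i , j) ∷ [] else [])
  member i j with toℕ i <ᵇ toℕ j in eq
  ... | true  = (λ i≡j → <⇒≢ (<ᵇ⇒< _ _ (subst T (sym eq) _)) (cong toℕ i≡j)) ∷ []
  ... | false = []

∈-pairsNe : ∀ {k} {i j : Fin k} → i ≢ j → (i , j) ∈ pairsNe k
∈-pairsNe {i = i} {j} i≢j = ∈-concatMap-allFin _ i (∈-concatMap-allFin _ j member)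
  where
  member : (i , j) ∈ (if toℕ i <ᵇ toℕ j then (i , j) ∷ [] else if toℕ j <ᵇ toℕ i then (i , j) ∷ [] else [])
  member with toℕ i <ᵇ toℕ j in eq | toℕ j <ᵇ toℕ i in eq'
  ... | true  | _     = here refl
  ... | false | true  = here refl
  ... | false | false = contradiction
    (toℕ-injective (≤-antisym (≮⇒≥ λ j<i → subst T eq' (<⇒<ᵇ j<i)) (≮⇒≥ λ i<j → subst T eq (<⇒<ᵇ i<j)))) i≢j

pairsNe-≢ : ∀ k → All (uncurry _≢_) (pairsNe k)
pairsNe-≢ k = All-concatMap _ (allFin k) λ {i} _ → All-concatMap _ (allFin k) λ {j} _ → member i j
  where
  member : ∀ i j → All (uncurry _≢_)
    (if toℕ i <ᵇ toℕ j then (i , j) ∷ [] else if toℕ j <ᵇ toℕ i then (i , j) ∷ [] else [])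
  member i j with toℕ i <ᵇ toℕ j in eq | toℕ j <ᵇ toℕ i in eq'
  ... | true  | _     = (λ i≡j → <⇒≢ (<ᵇ⇒< _ _ (subst T (sym eq) _)) (cong toℕ i≡j)) ∷ []
  ... | false | true  = (λ i≡j → <⇒≢ (<ᵇ⇒< _ _ (subst T (sym eq') _)) (cong toℕ (sym i≡j))) ∷ []
  ... | false | false = []

vtx-≢ : ∀ {n} (v : Fin n) u → vtx v u ≢ v
vtx-≢ v u eq = <⇒≢ (toℕ<n u) (trans (sym (toℕ-inject≤ u _)) (cong toℕ eq))

vtx-fromℕ< : ∀ {n} {u v : Fin n} (u<v : toℕ u < toℕ v) → vtx v (fromℕ< u<v) ≡ u
vtx-fromℕ< u<v = toℕ-injective (trans (toℕ-inject≤ _ _) (toℕ-fromℕ< u<v))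

record IsClique {n : ℕ} (a : PAssign n) (s : Fin (n / 2) → Fin n → Bool) : Set where
  field
    total    : ∀ i → ∃ λ u → s i u ≡ true
    distinct : ∀ {i j u} → i ≢ j → s i u ≡ true → s j u ≢ true
    unique   : ∀ {i u v} → u ≢ v → s i u ≡ true → s i v ≢ true
    adjacent : ∀ {i j} v u → i ≢ j → s i (vtx v u) ≡ true → s j v ≡ true → a v u ≡ true

module _ {n : ℕ} {a : PAssign n} {s : Fin (n / 2) → Fin n → Bool} where

  isClique⇒Sat : IsClique a s → Sat (aAssign a s) (A n)
  isClique⇒Sat cl =
    Allₚ.++⁺ (Allₚ.map⁺ (All.universal (λ i → Anyₚ.map⁺ (lose (∈-allFin (proj₁ (total i))) (proj₂ (total i)))) (allFin (n / 2))))
    (Allₚ.++⁺ (All-concatMap _ (pairsLt (n / 2)) λ {(i , j)} ij∈ →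
        Allₚ.map⁺ (All.universal (λ u → not-both (distinct (All.lookup (pairsLt-≢ (n / 2)) ij∈))) (allFin n)))
    (Allₚ.++⁺ (All-concatMap _ (allFin (n / 2)) λ {i} _ →
        Allₚ.map⁺ (All.universal (λ (v , u) → not-both (unique (vtx-≢ v u))) (pairs n)))
    (All-concatMap _ (pairsNe (n / 2)) λ {(i , j)} ij∈ →
        Allₚ.map⁺ (All.universal (λ (v , u) → both⇒ (adjacent v u (All.lookup (pairsNe-≢ (n / 2)) ij∈))) (pairs n)))))
    where
    open IsClique cl
    Holds : AVar n × Bool → Set
    Holds l = aAssign a s (proj₁ l) ≡ proj₂ l
    not-both : ∀ {x y} → (aAssign a s x ≡ true → aAssign a s y ≢ true) → Any Holds ((x , false) ∷ (y , false) ∷ [])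
    not-both {x} {y} h with aAssign a s x in eqx | aAssign a s y in eqy
    ... | false | _     = here eqx
    ... | true  | false = there (here eqy)
    ... | true  | true  = contradiction refl (h refl)
    both⇒ : ∀ {x y z} → (aAssign a s x ≡ true → aAssign a s y ≡ true → aAssign a s z ≡ true) →
      Any Holds ((x , false) ∷ (y , false) ∷ (z , true) ∷ [])
    both⇒ {x} {y} h with aAssign a s x in eqx | aAssign a s y in eqy
    ... | false | _     = here eqx
    ... | true  | false = there (here eqy)
    ... | true  | true  = there (there (here (h refl refl)))

  module FromSat (sat : Sat (aAssign a s) (A n)) where

    private
      rest₂ = Allₚ.++⁻ʳ (map (λ i → map (λ u → (aq i u , true)) (allFin n)) (allFin (n / 2))) sat
      part₂ = Allₚ.++⁻ˡ (concatMap (λ ij → map (λ u → (aq (proj₁ ij) u , false) ∷ (aq (proj₂ ij) u , false) ∷ []) (allFin n))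
                (pairsLt (n / 2))) rest₂
      rest₃ = Allₚ.++⁻ʳ (concatMap (λ ij → map (λ u → (aq (proj₁ ij) u , false) ∷ (aq (proj₂ ij) u , false) ∷ []) (allFin n))
                (pairsLt (n / 2))) rest₂
      rest₄ = Allₚ.++⁻ʳ (concatMap (λ i → map (λ vu →
                (aq i (vtx (proj₁ vu) (proj₂ vu)) , false) ∷ (aq i (proj₁ vu) , false) ∷ []) (pairs n)) (allFin (n / 2))) rest₃

    total : ∀ i → ∃ λ u → s i u ≡ true
    total i with find (Anyₚ.map⁻ (All.lookup (Allₚ.map⁻ (Allₚ.++⁻ˡ _ sat)) (∈-allFin i)))
    ... | u , _ , eq = u , eq

    distinct< : ∀ {i j u} → toℕ i < toℕ j → s i u ≡ true → s j u ≢ true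
    distinct< {i} {j} {u} i<j eqi eqj
      with All.lookup (Allₚ.map⁻ (All.lookup (Allₚ.map⁻ (Allₚ.concat⁻ part₂)) (∈-pairsLt i<j))) (∈-allFin u)
    ... | here eq         = case trans (sym eq) eqi of λ ()
    ... | there (here eq) = case trans (sym eq) eqj of λ ()

    adjacent : ∀ {i j} v u → i ≢ j → s i (vtx v u) ≡ true → s j v ≡ true → a v u ≡ true
    adjacent v u i≢j eqi eqj
      with All.lookup (Allₚ.map⁻ (All.lookup (Allₚ.map⁻ (Allₚ.concat⁻ rest₄)) (∈-pairsNe i≢j))) (∈-pairs v u)
    ... | here eq                 = case trans (sym eq) eqi of λ ()
    ... | there (here eq)         = case trans (sym eq) eqj of λ ()
    ... | there (there (here eq)) = eq

-- Padding: the core Fin (suc Q * Q) of the lower bound is joined to c universal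
-- vertices, which raises the clique size suc Q to n / 2, and to d isolated ones.
module Padding (Q ℓ' : ℕ) (Q≡4B : Q ≡ 4 * ((suc ℓ' + suc ℓ') * (suc ℓ' + suc ℓ'))) (ℓ≤k : suc ℓ' ≤ suc Q)
  (n c d : ℕ) (half : n / 2 ≡ suc Q + c) (split : n ≡ suc Q * Q + (c + d)) where

  open Approximation (suc Q) Q (suc ℓ')

  Kind : Set
  Kind = Fin N ⊎ Fin c ⊎ Fin d

  kind : Fin n → Kind
  kind v = map₂ (splitAt c) (splitAt N (cast split v))

  unkind : Kind → Fin n
  unkind x = cast (sym split) (join N (c + d) (map₂ (join c d) x))

  kind-unkind : ∀ x → kind (unkind x) ≡ x
  kind-unkind x = trans (cong (map₂ (splitAt c) ∘ splitAt N) (cast-involutive split (sym split) _))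
    (trans (cong (map₂ (splitAt c)) (splitAt-join N (c + d) (map₂ (join c d) x))) (back x))
    where
    back : ∀ x → map₂ (splitAt c) (map₂ (join c d) x) ≡ x
    back (inj₁ x) = refl
    back (inj₂ y) = cong inj₂ (splitAt-join c d y)

  unkind-kind : ∀ v → unkind (kind v) ≡ v
  unkind-kind v = trans (cong (cast (sym split) ∘ join N (c + d)) (back (splitAt N (cast split v))))
    (trans (cong (cast (sym split)) (join-splitAt N (c + d) (cast split v))) (cast-involutive (sym split) split v))
    where
    back : ∀ x → map₂ (join c d) (map₂ (splitAt c) x) ≡ x
    back (inj₁ x) = refl
    back (inj₂ y) = cong inj₂ (join-splitAt c d y)

  kind-injective : ∀ {u v} → kind u ≡ kind v → u ≡ v
  kind-injective eq = trans (sym (unkind-kind _)) (trans (cong unkind eq) (unkind-kind _))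

  unkind-injective : ∀ {x y} → unkind x ≡ unkind y → x ≡ y
  unkind-injective eq = trans (sym (kind-unkind _)) (trans (cong kind eq) (kind-unkind _))

  -- One table, used with values in `Bool` for the test graphs and with approximators for the
  -- inputs, so that both agree on the padding by construction.
  extend : {A : Set} (absent present : A) → (Vertex → Vertex → A) → Kind → Kind → A
  extend absent present R (inj₁ u)        (inj₁ v)        = R u v
  extend absent present R (inj₂ (inj₂ _)) _               = absent
  extend absent present R (inj₁ _)        (inj₂ (inj₂ _)) = absent
  extend absent present R (inj₂ (inj₁ _)) (inj₂ (inj₂ _)) = absent
  extend absent present R (inj₁ _)        (inj₂ (inj₁ _)) = present
  extend absent present R (inj₂ (inj₁ _)) (inj₁ _)        = present
  extend absent present R (inj₂ (inj₁ _)) (inj₂ (inj₁ _)) = present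

  picked : Pick → Vertex → Vertex → Bool
  picked f u v = ⌊ (¬? (u ≟ v) ×-dec (f (block u) ≟ slot u)) ×-dec (f (block v) ≟ slot v) ⌋

  separated : Colouring → Vertex → Vertex → Bool
  separated χ u v = ⌊ ¬? (χ u ≟ χ v) ⌋

  -- A single edge is represented without error: its term is the pair, its clause the partition that
  -- merges the pair. Equal ends never come from an edge variable; the case makes the function
  -- total.
  edgeᴬ : Vertex → Vertex → Approximator
  edgeᴬ u v with u ≟ v
  ... | yes _  = constᴬ false
  ... | no u≢v = record
    { terms    = (u ∷ v ∷ [] , two≤) ∷ []
    ; clauses  = (mergeParts trivial u v u≢v , two≤) ∷ []
    ; crossing = λ { (here refl) (here refl) → collide (here refl) (there (here refl)) u≢v (mergeFin-joins u≢v) }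
    }
    where
    two≤ : 2 ≤ suc ℓ' + suc ℓ'
    two≤ = +-mono-≤ {1} {suc ℓ'} {1} (s≤s z≤n) (s≤s z≤n)

  Edge : Set
  Edge = Σ (Fin n) (Fin ∘ toℕ)

  ends : {A : Set} → (Kind → Kind → A) → Edge → A
  ends R (v , u) = R (kind (vtx v u)) (kind v)

  input : Edge → Approximator
  input = ends (extend (constᴬ false) (constᴬ true) edgeᴬ)

  positive : Pick → Edge → Bool
  positive f = ends (extend false true (picked f))

  negative : Colouring → Edge → Bool
  negative χ = ends (extend false true (separated χ))

  edge⁺ : ∀ f u v → picked f u v ≡ true → Accepts f (edgeᴬ u v)
  edge⁺ f u v eq with u ≟ v | f (block u) ≟ slot u | f (block v) ≟ slot v
  edge⁺ f u v () | yes _ | _      | _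
  edge⁺ f u v () | no _  | no _   | _
  edge⁺ f u v () | no _  | yes _  | no _
  edge⁺ f u v _  | no _  | yes fu | yes fv = here (fu ∷ fv ∷ [])

  edge⁻ : ∀ χ u v → separated χ u v ≡ false → Rejects χ (edgeᴬ u v)
  edge⁻ χ u v eq with u ≟ v | χ u ≟ χ v
  edge⁻ χ u v _  | yes _  | _         = here (χ , λ _ → refl)
  edge⁻ χ u v () | no _   | no _
  edge⁻ χ u v _  | no u≢v | yes χu≡χv = here (mergeFin-factor u≢v χ χu≡χv)

  input⁺ : ∀ f e → positive f e ≡ true → Accepts f (input e)
  input⁺ f (v , u) = go (kind (vtx v u)) (kind v)
    where
    go : ∀ x y → extend false true (picked f) x y ≡ true → Accepts f (extend (constᴬ false) (constᴬ true) edgeᴬ x y)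
    go (inj₁ u)        (inj₁ v)        eq = edge⁺ f u v eq
    go (inj₁ _)        (inj₂ (inj₁ _)) _  = here []
    go (inj₂ (inj₁ _)) (inj₁ _)        _  = here []
    go (inj₂ (inj₁ _)) (inj₂ (inj₁ _)) _  = here []

  input⁻ : ∀ χ e → negative χ e ≡ false → Rejects χ (input e)
  input⁻ χ (v , u) = go (kind (vtx v u)) (kind v)
    where
    rejected : Rejects χ (constᴬ false)
    rejected = here (χ , λ _ → refl)
    go : ∀ x y → extend false true (separated χ) x y ≡ false → Rejects χ (extend (constᴬ false) (constᴬ true) edgeᴬ x y)
    go (inj₁ u)        (inj₁ v)        eq = edge⁻ χ u v eq
    go (inj₂ (inj₂ _)) _               _  = rejected
    go (inj₁ _)        (inj₂ (inj₂ _)) _  = rejected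
    go (inj₂ (inj₁ _)) (inj₂ (inj₂ _)) _  = rejected

  module _ (f : Pick) where

    corner : Fin (suc Q) → Vertex
    corner i = combine i (f i)

    f∋corner : ∀ i → f ∋ corner i
    f∋corner i = trans (cong (f ∘ proj₁) (remQuot-combine {suc Q} {Q} i (f i)))
                       (sym (cong proj₂ (remQuot-combine {suc Q} {Q} i (f i))))

    place : Fin (suc Q) ⊎ Fin c → Kind
    place = [ inj₁ ∘ corner , inj₂ ∘ inj₁ ]

    place-injective : ∀ {x y} → place x ≡ place y → x ≡ y
    place-injective {inj₁ i} {inj₁ j} eq =
      cong inj₁ (combine-injectiveˡ i (f i) j (f j) (inj₁-injective eq))
    place-injective {inj₂ p} {inj₂ .p} refl = refl

    place-adjacent : ∀ {x y} → x ≢ y → extend false true (picked f) (place x) (place y) ≡ true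
    place-adjacent {inj₁ i} {inj₁ j} x≢y
      with corner i ≟ corner j | f (block (corner i)) ≟ slot (corner i) | f (block (corner j)) ≟ slot (corner j)
    ... | no _   | yes _ | yes _  = refl
    ... | yes eq | _     | _      = contradiction (cong inj₁ (combine-injectiveˡ i (f i) j (f j) eq)) x≢y
    ... | no _   | no ∌  | _      = contradiction (f∋corner i) ∌
    ... | no _   | yes _ | no ∌   = contradiction (f∋corner j) ∌
    place-adjacent {inj₁ _} {inj₂ _} _ = refl
    place-adjacent {inj₂ _} {inj₁ _} _ = refl
    place-adjacent {inj₂ _} {inj₂ _} _ = refl

    role : Fin (n / 2) → Fin (suc Q) ⊎ Fin c
    role i = splitAt (suc Q) (cast half i)

    role-injective : ∀ {i j} → role i ≡ role j → i ≡ j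
    role-injective {i} {j} eq = trans (sym (back i)) (trans (cong (cast (sym half) ∘ join (suc Q) c) eq) (back j))
      where
      back : ∀ i → cast (sym half) (join (suc Q) c (role i)) ≡ i
      back i = trans (cong (cast (sym half)) (join-splitAt (suc Q) c (cast half i))) (cast-involutive (sym half) half i)

    selected : Fin (n / 2) → Fin n
    selected i = unkind (place (role i))

    selected-injective : ∀ {i j} → selected i ≡ selected j → i ≡ j
    selected-injective = role-injective ∘ place-injective ∘ unkind-injective

    selection : Fin (n / 2) → Fin n → Bool
    selection i u = ⌊ u ≟ selected i ⌋

    selection⇒≡ : ∀ {i u} → selection i u ≡ true → u ≡ selected i
    selection⇒≡ {i} {u} eq with u ≟ selected i
    ... | yes p = p

    selection-selected : ∀ i → selection i (selected i) ≡ true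
    selection-selected i with selected i ≟ selected i
    ... | yes _ = refl
    ... | no ¬p = contradiction refl ¬p

    positive-sat : ∃ λ s → Sat (aAssign (λ v u → positive f (v , u)) s) (A n)
    positive-sat = selection , isClique⇒Sat record
      { total    = λ i → selected i , selection-selected i
      ; distinct = λ i≢j eqi eqj → i≢j (selected-injective (trans (sym (selection⇒≡ eqi)) (selection⇒≡ eqj)))
      ; unique   = λ u≢v equ eqv → u≢v (trans (selection⇒≡ equ) (sym (selection⇒≡ eqv)))
      ; adjacent = λ {i} {j} v u i≢j eqi eqj → trans
          (cong₂ (extend false true (picked f))
            (trans (cong kind (selection⇒≡ eqi)) (kind-unkind (place (role i)))) (trans (cong kind (selection⇒≡ eqj)) (kind-unkind (place (role j)))))
          (place-adjacent (i≢j ∘ role-injective))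
      }

  module _ (χ : Colouring) where

    -- A proper colouring of the padded graph with Q + c colours, one fewer than the clique size:
    -- universal vertices get private colours, and isolated ones may share any core colour `q₀`.
    colour : Fin Q → Kind → Fin Q ⊎ Fin c
    colour q₀ = [ inj₁ ∘ χ , [ inj₂ , (λ _ → inj₁ q₀) ] ]

    adjacent⇒≡ : ∀ q₀ {x y} → colour q₀ x ≡ colour q₀ y → extend false true (separated χ) x y ≡ true → x ≡ y
    adjacent⇒≡ q₀ {inj₁ u} {inj₁ v} same adj with χ u ≟ χ v
    adjacent⇒≡ q₀ {inj₁ u} {inj₁ v} same ()  | yes _
    adjacent⇒≡ q₀ {inj₁ u} {inj₁ v} same adj | no χu≢χv = contradiction (inj₁-injective same) χu≢χv
    adjacent⇒≡ q₀ {inj₁ u} {inj₂ (inj₁ _)} () adj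
    adjacent⇒≡ q₀ {inj₁ u} {inj₂ (inj₂ _)} same ()
    adjacent⇒≡ q₀ {inj₂ (inj₁ p)} {inj₂ (inj₁ .p)} refl adj = refl

    negative-unsat : ¬ ∃ λ s → Sat (aAssign (λ v u → negative χ (v , u)) s) (A n)
    negative-unsat (s , sat) = go (pigeonhole fewer (λ i → join Q c (colour q₀ (kind (vertex i)))))
      where
      open FromSat sat
      q₀ : Fin Q
      q₀ = fromℕ< {0} (subst (0 <_) (sym Q≡4B) (s≤s z≤n))
      vertex : Fin (n / 2) → Fin n
      vertex i = proj₁ (total i)
      fewer : Q + c < n / 2
      fewer = ≤-reflexive (sym half)
      go : ¬ (∃₂ λ i j → toℕ i < toℕ j ×
        join Q c (colour q₀ (kind (vertex i))) ≡ join Q c (colour q₀ (kind (vertex j))))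
      go (i , j , i<j , eq) = impossible
        where
        i≢j : i ≢ j
        i≢j = <⇒≢ i<j ∘ cong toℕ
        same : colour q₀ (kind (vertex i)) ≡ colour q₀ (kind (vertex j))
        same = trans (sym (splitAt-join Q c _)) (trans (cong (splitAt Q) eq) (splitAt-join Q c _))
        differ : vertex i ≢ vertex j
        differ eq = distinct< i<j (proj₂ (total i)) (subst (λ u → s j u ≡ true) (sym eq) (proj₂ (total j)))
        joined : ∀ i j → i ≢ j → toℕ (vertex i) < toℕ (vertex j) →
          extend false true (separated χ) (kind (vertex i)) (kind (vertex j)) ≡ true
        joined i j i≢j lt = subst (λ u → extend false true (separated χ) (kind u) (kind (vertex j)) ≡ true) (vtx-fromℕ< lt)
          (adjacent (vertex j) (fromℕ< lt) i≢j (subst (λ u → s i u ≡ true) (sym (vtx-fromℕ< lt)) (proj₂ (total i)))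
            (proj₂ (total j)))
        impossible : ⊥
        -- An edge variable is indexed by its larger end, so the two chosen vertices have to be put
        -- in order before adjacency can be read off.
        impossible with <-cmp (toℕ (vertex i)) (toℕ (vertex j))
        ... | tri< lt _ _ = differ (kind-injective (adjacent⇒≡ q₀ same (joined i j i≢j lt)))
        ... | tri≈ _ e _  = differ (toℕ-injective e)
        ... | tri> _ _ gt = differ (sym (kind-injective (adjacent⇒≡ q₀ (sym same) (joined j i (i≢j ∘ sym) gt))))

  clique-size-bound : ∀ {l} (P : Prog Edge (suc l)) →
    (∀ a → (∃ λ s → Sat (aAssign a s) (A n)) → progVal P (uncurry a) zero ≡ true) →
    (∀ a → (¬ ∃ λ s → Sat (aAssign a s) (A n)) → progVal P (uncurry a) zero ≡ false) →
    2 ^ suc ℓ' ≤ suc l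
  clique-size-bound P accepts rejects = LowerBound.Bound.size-bound (suc Q) Q ℓ' Q≡4B ℓ≤k input positive negative input⁺ input⁻ P
    (λ f → accepts _ (positive-sat f)) (λ χ → rejects _ (negative-unsat χ))

-- Common ground of the two interpolation proofs

_≟ᵛ_ : ∀ {n m₁ m₂} (x y : PhiVar n m₁ m₂) → Dec (x ≡ y)
vp v u ≟ᵛ vp v' u' with v ≟ v'
... | no v≢v' = no λ { refl → v≢v' refl }
... | yes refl with u ≟ u'
...   | no u≢u'  = no λ { refl → u≢u' refl }
...   | yes refl = yes refl
vq i u ≟ᵛ vq i' u' with i ≟ i' | u ≟ u'
... | yes refl | yes refl = yes refl
... | no i≢i'  | _        = no λ { refl → i≢i' refl }
... | yes _    | no u≢u'  = no λ { refl → u≢u' refl }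
vr₁ j ≟ᵛ vr₁ j' with j ≟ j'
... | yes refl = yes refl
... | no j≢j'  = no λ { refl → j≢j' refl }
vr₂ j ≟ᵛ vr₂ j' with j ≟ j'
... | yes refl = yes refl
... | no j≢j'  = no λ { refl → j≢j' refl }
vp _ _ ≟ᵛ vq _ _ = no λ ()
vp _ _ ≟ᵛ vr₁ _  = no λ ()
vp _ _ ≟ᵛ vr₂ _  = no λ ()
vq _ _ ≟ᵛ vp _ _ = no λ ()
vq _ _ ≟ᵛ vr₁ _  = no λ ()
vq _ _ ≟ᵛ vr₂ _  = no λ ()
vr₁ _  ≟ᵛ vp _ _ = no λ ()
vr₁ _  ≟ᵛ vq _ _ = no λ ()
vr₁ _  ≟ᵛ vr₂ _  = no λ ()
vr₂ _  ≟ᵛ vp _ _ = no λ ()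
vr₂ _  ≟ᵛ vq _ _ = no λ ()
vr₂ _  ≟ᵛ vr₁ _  = no λ ()

PLiteralPositive : ∀ {n} → Lit (AVar n) → Set
PLiteralPositive (ap _ _ , b) = b ≡ true
PLiteralPositive (aq _ _ , b) = ⊤

A-monotone : ∀ n → All (All PLiteralPositive) (A n)
A-monotone n =
  Allₚ.++⁺ (Allₚ.map⁺ (All.universal (λ i → Allₚ.map⁺ (All.universal (λ u → tt) (allFin n))) (allFin (n / 2))))
  (Allₚ.++⁺ (All-concatMap _ (pairsLt (n / 2)) λ _ → Allₚ.map⁺ (All.universal (λ u → tt ∷ tt ∷ []) (allFin n)))
  (Allₚ.++⁺ (All-concatMap _ (allFin (n / 2)) λ _ → Allₚ.map⁺ (All.universal (λ u → tt ∷ tt ∷ []) (pairs n)))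
  (All-concatMap _ (pairsNe (n / 2)) λ _ → Allₚ.map⁺ (All.universal (λ u → tt ∷ tt ∷ refl ∷ []) (pairs n)))))

-- The literals are tagged as occurring in `F`, which lets a caller dismiss negative p-literals by
-- `A-monotone` instead of falsifying them.
falsified-clause : ∀ {V W : Set} {ρ : V → Bool} {F : CNF V} {M} (f : V → W) → Sat ρ F → M ∈ embCNF f F →
  ¬ (∀ {l} → l ∈ concatMap id F → (f (proj₁ l) , proj₂ l) ∈ M → ρ (proj₁ l) ≢ proj₂ l)
falsified-clause f sat M∈ falsified with ∈-map⁻ (map (λ l → f (proj₁ l) , proj₂ l)) M∈
... | C , C∈ , refl with find (All.lookup sat C∈)
...   | l , l∈ , true-l = falsified (∈-concatMap⁺ id (lose C∈ l∈)) (∈-map⁺ (λ l → f (proj₁ l) , proj₂ l) l∈) true-l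

module Interpolation (n m₁ m₂ : ℕ) (B : CNF (BVar n m₁ m₂)) where

  Φ : QBF
  Φ = Phi n m₁ m₂ B
  open QBF Φ

  Edge : Set
  Edge = Σ (Fin n) (Fin ∘ toℕ)

  AllAnswered : PAssign n → Set
  AllAnswered a = ∀ s₁ → ∃ λ s₂ → Sat (bAssign a s₁ s₂) B

  axiomGate : ∀ {l M} → M ∈ matrix → Gate Edge l
  axiomGate M∈ = const ([ (λ _ → false) , (λ _ → true) ]′ (∈-++⁻ (embCNF embA (A n)) M∈))

  -- A bit 0 speaks of p and q only, so on an r-pivot one premise with bit 0 settles the resolvent;
  -- a bit 1 ignores q, so on a q-pivot one premise with bit 1 does. At a p-pivot the usual selector
  -- would return `j` if p is true and `i` otherwise; returning 0 whenever `j` is 0 makes it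
  -- monotone.
  pivotGate : ∀ {l} → V → Fin l → Fin l → Gate Edge l
  pivotGate (vp v u) i j = sel (v , u) i j
  pivotGate (vq _ _) i j = or i j
  pivotGate (vr₁ _)  i j = and i j
  pivotGate (vr₂ _)  i j = and i j

  ind-r₁<r₂ : ∀ i j → ind (vr₁ i) < ind (vr₂ j)
  ind-r₁<r₂ i j = ≤-trans (+-monoʳ-< (n * n + (n / 2) * n) (toℕ<n i)) (m≤m+n _ (toℕ j))

  ind-r₁-cancel : ∀ {i j} → ind (vr₁ i) < ind (vr₁ j) → toℕ i < toℕ j
  ind-r₁-cancel = +-cancelˡ-< (n * n + (n / 2) * n) _ _

Local : ∀ {m} → (Fin m → (Fin m → Bool) → Bool) → Set
Local h = ∀ j {s s'} → (∀ i → toℕ i < toℕ j → s i ≡ s' i) → h j s ≡ h j s'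

-- A value depends on earlier values only, so entry `j` no longer changes after `toℕ j + 1` rounds,
-- and `m` rounds give the play that the strategy produces.
local-fixpoint : ∀ {m} (h : Fin m → (Fin m → Bool) → Bool) → Local h → ∃ λ s → ∀ j → s j ≡ h j s
local-fixpoint {m} h local = iterate m , λ j → stable m j (toℕ<n j)
  where
  iterate : ℕ → Fin m → Bool
  iterate zero    j = false
  iterate (suc k) j = h j (iterate k)
  stable : ∀ k j → toℕ j < k → iterate k j ≡ iterate (suc k) j
  stable (suc k) j (s≤s j≤k) = local j λ i i<j → stable k i (≤-trans i<j j≤k)

-- Interpolation for LQU⁺-Res

module LQU-Interpolation (n m₁ m₂ : ℕ) (B : CNF (BVar n m₁ m₂)) where

  open Interpolation n m₁ m₂ B
  open QBF Φ
  open LQU Φ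

  gate : ∀ {prev C} → LStep prev C → Gate Edge (length prev)
  gate (axiom M M∈ _)                    = axiomGate M∈
  gate (reduce D D∈ _ _ _ _ _ _)         = copy (index D∈)
  gate (resolve _ _ C₁∈ C₂∈ x _ _ _ _)   = pivotGate x (index C₁∈) (index C₂∈)

  prog : ∀ {cs} → Derivation cs → Prog Edge (length cs)
  prog []       = []
  prog (st ∷ δ) = gate st ∷ prog δ

  Falsified : LS → Bool → Set
  Falsified none b = ⊤
  Falsified pos  b = b ≡ false
  Falsified neg  b = b ≡ true
  Falsified star b = ⊥

  -- Negative p-literals do not count: no clause of A contains one.
  Falsified⁺ : LS → Bool → Set
  Falsified⁺ neg b = ⊤
  Falsified⁺ ls  b = Falsified ls b

  -- A merged literal is falsified when its variable follows the strategy value h.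
  Follows : LS → Bool → Bool → Set
  Follows none h b = ⊤
  Follows pos  h b = b ≡ false
  Follows neg  h b = b ≡ true
  Follows star h b = b ≡ h

  forced : LS → Bool → Bool
  forced pos h = false
  forced neg h = true
  forced _   h = h

  follows-forced : ∀ ls h → Follows ls h (forced ls h)
  follows-forced none h = tt
  follows-forced pos  h = refl
  follows-forced neg  h = refl
  follows-forced star h = refl

  -- The answer at one r₁-variable after resolution; `c` names the premise to be refuted, `true` the
  -- second. Only at merged variables does the choice matter, and these lie to the right of the
  -- pivot, so `c` may depend on the value of the pivot.
  mix : Bool → LS → LS → Bool → Bool → Bool
  mix c     none β    h₁ h₂ = h₂
  mix c     α    none h₁ h₂ = h₁
  mix true  α    β    h₁ h₂ = forced β h₂
  mix false α    β    h₁ h₂ = forced α h₁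

  mix-left : ∀ {x v α β γ} c {h₁ h₂ b} → (quant v ≡ ∀q → ind x < ind v → c ≡ false) → ResV x v α β γ →
    Follows γ (mix c α β h₁ h₂) b → Follows α h₁ b
  mix-left c c≡ left f = tt
  mix-left c c≡ (right {none}) f = tt
  mix-left c c≡ (right {pos})  f = f
  mix-left c c≡ (right {neg})  f = f
  mix-left c c≡ (right {star}) f = f
  mix-left c c≡ (same {none} _) f = tt
  mix-left c c≡ (same {pos}  _) f = f
  mix-left c c≡ (same {neg}  _) f = f
  mix-left c c≡ (same {star} ≢star) f = contradiction refl ≢star
  mix-left c c≡ (merge ∀v x<v m) f with c | c≡ ∀v x<v
  mix-left c c≡ (merge ∀v x<v pn) f | false | refl = f
  mix-left c c≡ (merge ∀v x<v np) f | false | refl = f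
  mix-left c c≡ (merge ∀v x<v (sl {none} ≢none)) f | false | refl = contradiction refl ≢none
  mix-left c c≡ (merge ∀v x<v (sl {pos}  _)) f | false | refl = f
  mix-left c c≡ (merge ∀v x<v (sl {neg}  _)) f | false | refl = f
  mix-left c c≡ (merge ∀v x<v (sl {star} _)) f | false | refl = f
  mix-left c c≡ (merge ∀v x<v (sr {none} _)) f | false | refl = tt
  mix-left c c≡ (merge ∀v x<v (sr {pos}  _)) f | false | refl = f
  mix-left c c≡ (merge ∀v x<v (sr {neg}  _)) f | false | refl = f
  mix-left c c≡ (merge ∀v x<v (sr {star} _)) f | false | refl = f

  mix-right : ∀ {x v α β γ} c {h₁ h₂ b} → (quant v ≡ ∀q → ind x < ind v → c ≡ true) → ResV x v α β γ →
    Follows γ (mix c α β h₁ h₂) b → Follows β h₂ b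
  mix-right c c≡ right f = tt
  mix-right c c≡ left f = f
  mix-right c c≡ (same {none} _) f = tt
  mix-right c c≡ (same {pos}  _) f = f
  mix-right c c≡ (same {neg}  _) f = f
  mix-right c c≡ (same {star} ≢star) f = contradiction refl ≢star
  mix-right c c≡ (merge ∀v x<v m) f with c | c≡ ∀v x<v
  mix-right c c≡ (merge ∀v x<v pn) f | true | refl = f
  mix-right c c≡ (merge ∀v x<v np) f | true | refl = f
  mix-right c c≡ (merge ∀v x<v (sr {none} ≢none)) f | true | refl = contradiction refl ≢none
  mix-right c c≡ (merge ∀v x<v (sr {pos}  _)) f | true | refl = f
  mix-right c c≡ (merge ∀v x<v (sr {neg}  _)) f | true | refl = f
  mix-right c c≡ (merge ∀v x<v (sr {star} _)) f | true | refl = f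
  mix-right c c≡ (merge ∀v x<v (sl {none} _)) f | true | refl = tt
  mix-right c c≡ (merge ∀v x<v (sl {pos}  _)) f | true | refl = f
  mix-right c c≡ (merge ∀v x<v (sl {neg}  _)) f | true | refl = f
  mix-right c c≡ (merge ∀v x<v (sl {star} _)) f | true | refl = f

  Strategy : Set
  Strategy = Fin m₁ → (Fin m₁ → Bool) → Bool

  Consistent : LClause → Strategy → (Fin m₁ → Bool) → Set
  Consistent C h s = ∀ j → Follows (C (vr₁ j)) (h j s) (s j)

  consistent-play : ∀ C h → Local h → ∃ (Consistent C h)
  consistent-play C h local with local-fixpoint (λ j s → forced (C (vr₁ j)) (h j s)) (λ j eq → cong (forced (C (vr₁ j))) (local j eq))
  ... | s , fix = s , λ j → subst (Follows (C (vr₁ j)) (h j s)) (sym (fix j)) (follows-forced (C (vr₁ j)) (h j s))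

  module _ {C₁ C₂ C : LClause} {x : V} (C₁x : C₁ x ≡ pos) (C₂x : C₂ x ≡ neg)
    (res : ∀ v → v ≢ x → ResV x v (C₁ v) (C₂ v) (C v)) where

    -- Existential literals never merge, so away from the pivot a premise contains the literal of
    -- the resolvent or none.
    premise₁ : ∀ (F : LS → Set) v → quant v ≡ ∃q → F none → (v ≡ x → F pos) → F (C v) → F (C₁ v)
    premise₁ F v ∃v F-none F-pivot FC with v ≟ᵛ x
    ... | yes refl = subst F (sym C₁x) (F-pivot refl)
    ... | no v≢x with C₁ v | C₂ v | C v | res v v≢x
    ...   | _ | _ | _ | left           = F-none
    ...   | _ | _ | _ | right          = FC
    ...   | _ | _ | _ | same _         = FC
    ...   | _ | _ | _ | merge ∀v _ _   = case trans (sym ∃v) ∀v of λ ()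

    premise₂ : ∀ (F : LS → Set) v → quant v ≡ ∃q → F none → (v ≡ x → F neg) → F (C v) → F (C₂ v)
    premise₂ F v ∃v F-none F-pivot FC with v ≟ᵛ x
    ... | yes refl = subst F (sym C₂x) (F-pivot refl)
    ... | no v≢x with C₁ v | C₂ v | C v | res v v≢x
    ...   | _ | _ | _ | left           = FC
    ...   | _ | _ | _ | right          = F-none
    ...   | _ | _ | _ | same _         = FC
    ...   | _ | _ | _ | merge ∀v _ _   = case trans (sym ∃v) ∀v of λ ()

  module _ (a : PAssign n) where

    FalseP : LClause → Set
    FalseP C = ∀ v u → Falsified (C (vp v u)) (a v u)

    FalseP⁺ : LClause → Set
    FalseP⁺ C = ∀ v u → Falsified⁺ (C (vp v u)) (a v u)

    FalseQ : (Fin (n / 2) → Fin n → Bool) → LClause → Set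
    FalseQ s C = ∀ i u → Falsified (C (vq i u)) (s i u)

    -- With `FalseP⁺` the clause follows even after its negative p-literals are deleted. This
    -- stronger invariant lets bit 0 pass from the second premise of a p-pivot whatever the value of
    -- p.
    FollowsFrom-A : LClause → Set
    FollowsFrom-A C = ∀ s → Sat (aAssign a s) (A n) → FalseP⁺ C → FalseQ s C → ⊥

    Valid : LClause → Strategy → Set
    Valid C h = ∀ s₁ → Consistent C h s₁ → ∀ s₂ → Sat (bAssign a s₁ s₂) B →
      ¬ (∀ j → Falsified (C (vr₂ j)) (s₂ j))

    FollowsFrom-B : LClause → Set
    FollowsFrom-B C = FalseP C → ∃ λ h → Local h × Valid C h

    axiom-A : ∀ {M C} → M ∈ embCNF embA (A n) → Represents M C → FollowsFrom-A C
    axiom-A {M} {C} M∈ rep s sat falseP falseQ = falsified-clause embA sat M∈ literal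
      where
      literal : ∀ {l} → l ∈ concatMap id (A n) → (embA (proj₁ l) , proj₂ l) ∈ M → aAssign a s (proj₁ l) ≢ proj₂ l
      literal {ap v u , true} _ l∈ eq = case trans (sym eq)
        (subst (λ ls → Falsified⁺ ls (a v u)) (proj₂ (proj₁ (rep (vp v u))) l∈) (falseP v u)) of λ ()
      literal {ap v u , false} l∈A _ _ = case All.lookup (Allₚ.concat⁺ (Allₚ.map⁺ (A-monotone n))) l∈A of λ ()
      literal {aq i u , true} _ l∈ eq = case trans (sym eq)
        (subst (λ ls → Falsified ls (s i u)) (proj₂ (proj₁ (rep (vq i u))) l∈) (falseQ i u)) of λ ()
      literal {aq i u , false} _ l∈ eq = case trans (sym eq)
        (subst (λ ls → Falsified ls (s i u)) (proj₂ (proj₁ (proj₂ (rep (vq i u)))) l∈) (falseQ i u)) of λ ()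

    axiom-B : ∀ {M C} → M ∈ embCNF embB B → Represents M C → FollowsFrom-B C
    -- A matrix clause has no merged literals, so a constant strategy serves.
    axiom-B {M} {C} M∈ rep falseP = (λ _ _ → false) , (λ _ _ → refl) , valid
      where
      valid : Valid C (λ _ _ → false)
      valid s₁ cons s₂ sat falseR = falsified-clause embB sat M∈ literal
        where
        opposite : ∀ x b {F : LS → Bool → Set} → (∀ {y} → F pos y → y ≡ false) → (∀ {y} → F neg y → y ≡ true) →
          (x , b) ∈ M → ∀ {y} → F (C x) y → y ≢ b
        opposite x true  {F} F-pos _ l∈ {y} f eq =
          case trans (sym eq) (F-pos (subst (λ ls → F ls y) (proj₂ (proj₁ (rep x)) l∈) f)) of λ ()
        opposite x false {F} _ F-neg l∈ {y} f eq =
          case trans (sym eq) (F-neg (subst (λ ls → F ls y) (proj₂ (proj₁ (proj₂ (rep x))) l∈) f)) of λ ()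
        literal : ∀ {l} → l ∈ concatMap id B → (embB (proj₁ l) , proj₂ l) ∈ M → bAssign a s₁ s₂ (proj₁ l) ≢ proj₂ l
        literal {bp v u , b} _ l∈ = opposite (vp v u) b {Falsified} id id l∈ (falseP v u)
        literal {br₁ j , b}  _ l∈ = opposite (vr₁ j) b {λ ls y → Follows ls false y} id id l∈ (cons j)
        literal {br₂ j , b}  _ l∈ = opposite (vr₂ j) b {Falsified} id id l∈ (falseR j)

    reduce-A : ∀ {D C u} → quant u ≡ ∀q → (∀ v → v ≢ u → C v ≡ D v) → FollowsFrom-A D → FollowsFrom-A C
    reduce-A {u = vr₁ _} ∀u eq ihD s sat falseP falseQ = ihD s sat
      (λ v u → subst (λ ls → Falsified⁺ ls (a v u)) (eq (vp v u) λ ()) (falseP v u))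
      (λ i u → subst (λ ls → Falsified ls (s i u)) (eq (vq i u) λ ()) (falseQ i u))

    -- After p is fixed, ∀-reduction only applies to clauses without r₂-literals,
    -- and such a clause already yields a winning play of the universal player.
    reduce-B : ∀ {D C u} → AllAnswered a → quant u ≡ ∀q → (∀ v → v ≢ u → C v ≡ D v) →
      (∀ e → quant e ≡ ∃q → C e ≢ none → ind e ≤ ind u) → FollowsFrom-B D → FollowsFrom-B C
    reduce-B {D} {C} {vr₁ k} answered ∀u eq bound ihD falseP
      with ihD (λ v u → subst (λ ls → Falsified ls (a v u)) (eq (vp v u) λ ()) (falseP v u))
    ... | h , local , valid with consistent-play D h local
    ...   | s₁ , cons with answered s₁
    ...     | s₂ , sat = ⊥-elim (valid s₁ cons s₂ sat no-r₂)
      where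
      no-r₂ : ∀ j → Falsified (D (vr₂ j)) (s₂ j)
      no-r₂ j = subst (λ ls → Falsified ls (s₂ j)) (eq (vr₂ j) λ ()) (absent (C (vr₂ j)) refl)
        where
        absurd : C (vr₂ j) ≢ none → ⊥
        absurd ≢none = <⇒≱ (ind-r₁<r₂ k j) (bound (vr₂ j) refl ≢none)
        absent : ∀ ls → C (vr₂ j) ≡ ls → Falsified ls (s₂ j)
        absent none _ = tt
        absent pos  e = ⊥-elim (absurd λ e' → case trans (sym e) e' of λ ())
        absent neg  e = ⊥-elim (absurd λ e' → case trans (sym e) e' of λ ())
        absent star e = ⊥-elim (absurd λ e' → case trans (sym e) e' of λ ())

    module Resolution {C₁ C₂ C : LClause} {x : V} (C₁x : C₁ x ≡ pos) (C₂x : C₂ x ≡ neg)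
      (res : ∀ v → v ≢ x → ResV x v (C₁ v) (C₂ v) (C v)) where

      from₁-A : (∀ {v u} → vp v u ≡ x → a v u ≡ false) → FollowsFrom-A C₁ →
        ∀ s → (∀ {i u} → vq i u ≡ x → s i u ≡ false) → Sat (aAssign a s) (A n) → FalseP⁺ C → FalseQ s C → ⊥
      from₁-A p-pivot ih s q-pivot sat falseP falseQ = ih s sat
        (λ v u → premise₁ C₁x C₂x res (λ ls → Falsified⁺ ls (a v u)) (vp v u) refl tt p-pivot (falseP v u))
        (λ i u → premise₁ C₁x C₂x res (λ ls → Falsified ls (s i u)) (vq i u) refl tt q-pivot (falseQ i u))

      from₂-A : FollowsFrom-A C₂ →
        ∀ s → (∀ {i u} → vq i u ≡ x → s i u ≡ true) → Sat (aAssign a s) (A n) → FalseP⁺ C → FalseQ s C → ⊥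
      from₂-A ih s q-pivot sat falseP falseQ = ih s sat
        (λ v u → premise₂ C₁x C₂x res (λ ls → Falsified⁺ ls (a v u)) (vp v u) refl tt (λ _ → tt) (falseP v u))
        (λ i u → premise₂ C₁x C₂x res (λ ls → Falsified ls (s i u)) (vq i u) refl tt q-pivot (falseQ i u))

      falseP₁ : (∀ {v u} → vp v u ≡ x → a v u ≡ false) → FalseP C → FalseP C₁
      falseP₁ pivot falseP v u =
        premise₁ C₁x C₂x res (λ ls → Falsified ls (a v u)) (vp v u) refl tt pivot (falseP v u)

      falseP₂ : (∀ {v u} → vp v u ≡ x → a v u ≡ true) → FalseP C → FalseP C₂
      falseP₂ pivot falseP v u =
        premise₂ C₁x C₂x res (λ ls → Falsified ls (a v u)) (vp v u) refl tt pivot (falseP v u)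

      mixed : (Fin m₁ → (Fin m₁ → Bool) → Bool) → Strategy → Strategy → Strategy
      mixed c h₁ h₂ j s = mix (c j s) (C₁ (vr₁ j)) (C₂ (vr₁ j)) (h₁ j s) (h₂ j s)

      mixed-local : ∀ {c h₁ h₂} → Local c → Local h₁ → Local h₂ → Local (mixed c h₁ h₂)
      mixed-local lc l₁ l₂ j eq = cong₂ (λ c (h : Bool × Bool) → mix c (C₁ (vr₁ j)) (C₂ (vr₁ j)) (proj₁ h) (proj₂ h))
        (lc j eq) (cong₂ _,_ (l₁ j eq) (l₂ j eq))

      consistent₁ : ∀ {c h₁ h₂ s} → (∀ j → ind x < ind (vr₁ j) → c j s ≡ false) → (∀ {j} → vr₁ j ≡ x → s j ≡ false) →
        Consistent C (mixed c h₁ h₂) s → Consistent C₁ h₁ s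
      consistent₁ {c} {h₁} {s = s} c≡ pivot cons j with vr₁ j ≟ᵛ x
      ... | yes refl = subst (λ ls → Follows ls (h₁ j s) (s j)) (sym C₁x) (pivot refl)
      ... | no j≢x   = mix-left (c j s) (λ _ → c≡ j) (res (vr₁ j) j≢x) (cons j)

      consistent₂ : ∀ {c h₁ h₂ s} → (∀ j → ind x < ind (vr₁ j) → c j s ≡ true) → (∀ {j} → vr₁ j ≡ x → s j ≡ true) →
        Consistent C (mixed c h₁ h₂) s → Consistent C₂ h₂ s
      consistent₂ {c} {h₁} {h₂} {s} c≡ pivot cons j with vr₁ j ≟ᵛ x
      ... | yes refl = subst (λ ls → Follows ls (h₂ j s) (s j)) (sym C₂x) (pivot refl)
      ... | no j≢x   = mix-right (c j s) (λ _ → c≡ j) (res (vr₁ j) j≢x) (cons j)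

      falseR₁ : ∀ (s₂ : Fin m₂ → Bool) → (∀ {j} → vr₂ j ≡ x → s₂ j ≡ false) → (∀ j → Falsified (C (vr₂ j)) (s₂ j)) →
        ∀ j → Falsified (C₁ (vr₂ j)) (s₂ j)
      falseR₁ s₂ pivot falseR j =
        premise₁ C₁x C₂x res (λ ls → Falsified ls (s₂ j)) (vr₂ j) refl tt pivot (falseR j)

      falseR₂ : ∀ (s₂ : Fin m₂ → Bool) → (∀ {j} → vr₂ j ≡ x → s₂ j ≡ true) → (∀ j → Falsified (C (vr₂ j)) (s₂ j)) →
        ∀ j → Falsified (C₂ (vr₂ j)) (s₂ j)
      falseR₂ s₂ pivot falseR j =
        premise₂ C₁x C₂x res (λ ls → Falsified ls (s₂ j)) (vr₂ j) refl tt pivot (falseR j)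

      -- On a p-pivot false under `a`, or on a q-pivot, the first premise already refutes the
      -- resolvent; the constant choice `false` follows its strategy throughout.
      from₁-B : (∀ j → vr₁ j ≢ x) → (∀ j → vr₂ j ≢ x) → (∀ {v u} → vp v u ≡ x → a v u ≡ false) →
        FollowsFrom-B C₁ → FollowsFrom-B C
      from₁-B r₁≢x r₂≢x p-pivot ih falseP with ih (falseP₁ p-pivot falseP)
      ... | h₁ , local , valid = mixed (λ _ _ → false) h₁ (λ _ _ → false)
        , mixed-local {λ _ _ → false} {h₁} {λ _ _ → false} (λ _ _ → refl) local (λ _ _ → refl)
        , λ s₁ cons s₂ sat falseR → valid s₁
            (consistent₁ {λ _ _ → false} {h₁} {λ _ _ → false} {s₁} (λ _ _ → refl) (λ {j} eq → contradiction eq (r₁≢x j)) cons) s₂ sat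
            (falseR₁ s₂ (λ {j} eq → contradiction eq (r₂≢x j)) falseR)

      from₂-B : (∀ j → vr₁ j ≢ x) → (∀ j → vr₂ j ≢ x) → (∀ {v u} → vp v u ≡ x → a v u ≡ true) →
        FollowsFrom-B C₂ → FollowsFrom-B C
      from₂-B r₁≢x r₂≢x p-pivot ih falseP with ih (falseP₂ p-pivot falseP)
      ... | h₂ , local , valid = mixed (λ _ _ → true) (λ _ _ → false) h₂
        , mixed-local {λ _ _ → true} {λ _ _ → false} {h₂} (λ _ _ → refl) (λ _ _ → refl) local
        , λ s₁ cons s₂ sat falseR → valid s₁
            (consistent₂ {λ _ _ → true} {λ _ _ → false} {h₂} {s₁} (λ _ _ → refl) (λ {j} eq → contradiction eq (r₁≢x j)) cons) s₂ sat
            (falseR₂ s₂ (λ {j} eq → contradiction eq (r₂≢x j)) falseR)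

    module _ {C₁ C₂ C : LClause} where

      resolve-A : ∀ x → C₁ x ≡ pos → C₂ x ≡ neg → (∀ v → v ≢ x → ResV x v (C₁ v) (C₂ v) (C v)) →
        ∀ {l} (val : Fin l → Bool) i j →
        (val i ≡ false → FollowsFrom-A C₁) → (val j ≡ false → FollowsFrom-A C₂) →
        gateVal (uncurry a) val (pivotGate x i j) ≡ false → FollowsFrom-A C
      resolve-A (vp v u) C₁x C₂x res val i j ih₁ ih₂ eq s with val j in eqj | a v u in eqa | val i in eqi
      ... | false | _     | _     = from₂-A (ih₂ refl) s (λ ())
        where open Resolution {C₁} {C₂} {C} C₁x C₂x res
      ... | true  | false | false = from₁-A (λ { refl → eqa }) (ih₁ refl) s (λ ())
        where open Resolution {C₁} {C₂} {C} C₁x C₂x res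
      resolve-A (vq k u) C₁x C₂x res val i j ih₁ ih₂ eq s with val i in eqi | val j in eqj | s k u in eqs
      ... | false | false | false = from₁-A (λ ()) (ih₁ refl) s (λ { refl → eqs })
        where open Resolution {C₁} {C₂} {C} C₁x C₂x res
      ... | false | false | true  = from₂-A (ih₂ refl) s (λ { refl → eqs })
        where open Resolution {C₁} {C₂} {C} C₁x C₂x res
      resolve-A (vr₁ _) C₁x C₂x res val i j ih₁ ih₂ eq s with val i in eqi | val j in eqj
      ... | false | _     = from₁-A (λ ()) (ih₁ refl) s (λ ())
        where open Resolution {C₁} {C₂} {C} C₁x C₂x res
      ... | true  | false = from₂-A (ih₂ refl) s (λ ())
        where open Resolution {C₁} {C₂} {C} C₁x C₂x res
      resolve-A (vr₂ _) C₁x C₂x res val i j ih₁ ih₂ eq s with val i in eqi | val j in eqj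
      ... | false | _     = from₁-A (λ ()) (ih₁ refl) s (λ ())
        where open Resolution {C₁} {C₂} {C} C₁x C₂x res
      ... | true  | false = from₂-A (ih₂ refl) s (λ ())
        where open Resolution {C₁} {C₂} {C} C₁x C₂x res

      resolve-B : ∀ x → C₁ x ≡ pos → C₂ x ≡ neg → (∀ v → v ≢ x → ResV x v (C₁ v) (C₂ v) (C v)) →
        ∀ {l} (val : Fin l → Bool) i j →
        (val i ≡ true → FollowsFrom-B C₁) → (val j ≡ true → FollowsFrom-B C₂) →
        gateVal (uncurry a) val (pivotGate x i j) ≡ true → FollowsFrom-B C
      resolve-B (vp v u) C₁x C₂x res val i j ih₁ ih₂ eq with val j in eqj | a v u in eqa | val i in eqi
      ... | true | true  | _    = from₂-B (λ _ ()) (λ _ ()) (λ { refl → eqa }) (ih₂ refl)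
        where open Resolution {C₁} {C₂} {C} C₁x C₂x res
      ... | true | false | true = from₁-B (λ _ ()) (λ _ ()) (λ { refl → eqa }) (ih₁ refl)
        where open Resolution {C₁} {C₂} {C} C₁x C₂x res
      resolve-B (vq k u) C₁x C₂x res val i j ih₁ ih₂ eq with val i in eqi | val j in eqj
      ... | true  | _    = from₁-B (λ _ ()) (λ _ ()) (λ ()) (ih₁ refl)
        where open Resolution {C₁} {C₂} {C} C₁x C₂x res
      ... | false | true = from₂-B (λ _ ()) (λ _ ()) (λ ()) (ih₂ refl)
        where open Resolution {C₁} {C₂} {C} C₁x C₂x res
      resolve-B (vr₁ k) C₁x C₂x res val i j ih₁ ih₂ eq falseP with val i in eqi | val j in eqj
      ... | true | true = both (ih₁ refl (falseP₁ (λ ()) falseP)) (ih₂ refl (falseP₂ (λ ()) falseP))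
        where
        open Resolution {C₁} {C₂} {C} C₁x C₂x res
        -- The value of the pivot decides which premise is falsified there. It may be consulted only
        -- at later variables; the guard on the order makes `c` local.
        c : Strategy
        c j s = (toℕ k <ᵇ toℕ j) ∧ s k
        c-local : Local c
        c-local j eq with toℕ k <ᵇ toℕ j in k<j
        ... | true  = eq k (<ᵇ⇒< _ _ (subst T (sym k<j) _))
        ... | false = refl
        c≡ : ∀ {s b} → s k ≡ b → ∀ j → ind (vr₁ k) < ind (vr₁ j) → c j s ≡ b
        c≡ {s} sk j k<j with toℕ k <ᵇ toℕ j | <⇒<ᵇ (ind-r₁-cancel {k} {j} k<j)
        ... | true | _ = sk
        both : (∃ λ h → Local h × Valid C₁ h) → (∃ λ h → Local h × Valid C₂ h) → ∃ λ h → Local h × Valid C h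
        both (h₁ , l₁ , valid₁) (h₂ , l₂ , valid₂) = mixed c h₁ h₂ , mixed-local {c} {h₁} {h₂} c-local l₁ l₂ , valid
          where
          valid : Valid C (mixed c h₁ h₂)
          valid s₁ cons s₂ sat falseR = go (s₁ k) refl
            where
            go : ∀ b → s₁ k ≡ b → ⊥
            go false sk = valid₁ s₁ (consistent₁ {c} {h₁} {h₂} {s₁} (c≡ {s₁} sk) (λ { refl → sk }) cons) s₂ sat (falseR₁ s₂ (λ ()) falseR)
            go true  sk = valid₂ s₁ (consistent₂ {c} {h₁} {h₂} {s₁} (c≡ {s₁} sk) (λ { refl → sk }) cons) s₂ sat (falseR₂ s₂ (λ ()) falseR)
      resolve-B (vr₂ k) C₁x C₂x res val i j ih₁ ih₂ eq falseP with val i in eqi | val j in eqj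
      ... | true | true = both (ih₁ refl (falseP₁ (λ ()) falseP)) (ih₂ refl (falseP₂ (λ ()) falseP))
        where
        open Resolution {C₁} {C₂} {C} C₁x C₂x res
        -- No r₁-variable lies to the right of an r₂-pivot, so nothing merges and any choice is
        -- consistent with both premises.
        c : Strategy
        c _ _ = false
        never : ∀ {b} j → ind (vr₂ k) < ind (vr₁ j) → false ≡ b
        never j lt = contradiction lt (<-asym (ind-r₁<r₂ j k))
        both : (∃ λ h → Local h × Valid C₁ h) → (∃ λ h → Local h × Valid C₂ h) → ∃ λ h → Local h × Valid C h
        both (h₁ , l₁ , valid₁) (h₂ , l₂ , valid₂) = mixed c h₁ h₂ , mixed-local {c} {h₁} {h₂} (λ _ _ → refl) l₁ l₂ , valid
          where
          valid : Valid C (mixed c h₁ h₂)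
          valid s₁ cons s₂ sat falseR with s₂ k in sk
          ... | false = valid₁ s₁ (consistent₁ {c} {h₁} {h₂} {s₁} never (λ ()) cons) s₂ sat (falseR₁ s₂ (λ { refl → sk }) falseR)
          ... | true  = valid₂ s₁ (consistent₂ {c} {h₁} {h₂} {s₁} never (λ ()) cons) s₂ sat (falseR₂ s₂ (λ { refl → sk }) falseR)

    step-A : ∀ {prev C} (st : LStep prev C) (val : Fin (length prev) → Bool) →
      (∀ {D} (D∈ : D ∈ prev) → val (index D∈) ≡ false → FollowsFrom-A D) →
      gateVal (uncurry a) val (gate st) ≡ false → FollowsFrom-A C
    step-A (axiom M M∈ rep) val ih eq with ∈-++⁻ (embCNF embA (A n)) M∈
    ... | inj₁ M∈A = axiom-A M∈A rep
    step-A (reduce D D∈ u ∀u _ _ agree _) val ih eq = reduce-A ∀u agree (ih D∈ eq)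
    step-A (resolve C₁ C₂ C₁∈ C₂∈ x C₁x C₂x _ res) val ih eq =
      resolve-A x C₁x C₂x res val (index C₁∈) (index C₂∈) (ih C₁∈) (ih C₂∈) eq

    step-B : AllAnswered a → ∀ {prev C} (st : LStep prev C) (val : Fin (length prev) → Bool) →
      (∀ {D} (D∈ : D ∈ prev) → val (index D∈) ≡ true → FollowsFrom-B D) →
      gateVal (uncurry a) val (gate st) ≡ true → FollowsFrom-B C
    step-B answered (axiom M M∈ rep) val ih eq with ∈-++⁻ (embCNF embA (A n)) M∈
    ... | inj₂ M∈B = axiom-B M∈B rep
    step-B answered (reduce D D∈ u ∀u _ _ agree bound) val ih eq = reduce-B answered ∀u agree bound (ih D∈ eq)
    step-B answered (resolve C₁ C₂ C₁∈ C₂∈ x C₁x C₂x _ res) val ih eq =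
      resolve-B x C₁x C₂x res val (index C₁∈) (index C₂∈) (ih C₁∈) (ih C₂∈) eq

    derived-A : ∀ {cs} (δ : Derivation cs) {C} (C∈ : C ∈ cs) →
      progVal (prog δ) (uncurry a) (index C∈) ≡ false → FollowsFrom-A C
    derived-A (st ∷ δ) (here refl) = step-A st (progVal (prog δ) (uncurry a)) (derived-A δ)
    derived-A (st ∷ δ) (there C∈)  = derived-A δ C∈

    derived-B : AllAnswered a → ∀ {cs} (δ : Derivation cs) {C} (C∈ : C ∈ cs) →
      progVal (prog δ) (uncurry a) (index C∈) ≡ true → FollowsFrom-B C
    derived-B answered (st ∷ δ) (here refl) = step-B answered st (progVal (prog δ) (uncurry a)) (derived-B answered δ)
    derived-B answered (st ∷ δ) (there C∈)  = derived-B answered δ C∈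

    module _ (π : Refutation) where
      open Refutation π

      interpolant-A : progVal (prog steps) (uncurry a) zero ≡ false → ¬ ∃ λ s → Sat (aAssign a s) (A n)
      interpolant-A eq (s , sat) = derived-A steps (here refl) eq s sat
        (λ v u → subst (λ ls → Falsified⁺ ls (a v u)) (sym (empty (vp v u))) tt)
        (λ i u → subst (λ ls → Falsified ls (s i u)) (sym (empty (vq i u))) tt)

      interpolant-B : progVal (prog steps) (uncurry a) zero ≡ true → ¬ AllAnswered a
      interpolant-B eq answered
        with derived-B answered steps (here refl) eq
               (λ v u → subst (λ ls → Falsified ls (a v u)) (sym (empty (vp v u))) tt)
      ... | h , local , valid with answered (λ _ → false)
      ...   | s₂ , sat = valid (λ _ → false)
        (λ j → subst (λ ls → Follows ls (h j (λ _ → false)) false) (sym (empty (vr₁ j))) tt) s₂ sat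
        (λ j → subst (λ ls → Falsified ls (s₂ j)) (sym (empty (vr₂ j))) tt)

-- Interpolation for IRM-calc

truth : Maybe V3 → Maybe Bool
truth nothing  = nothing
truth (just 𝟘) = just false
truth (just 𝟙) = just true
truth (just ✱) = just false

-- A `✱` matches either value but not an undefined one, so matching preserves domains; the
-- resolution step compares domains to see that two assignments are compatible.
data Matches : Maybe V3 → Maybe Bool → Set where
  undef : Matches nothing nothing
  is𝟘   : Matches (just 𝟘) (just false)
  is𝟙   : Matches (just 𝟙) (just true)
  is✱   : ∀ {b} → Matches (just ✱) (just b)

matches? : ∀ α r → Dec (Matches α r)
matches? nothing  nothing      = yes undef
matches? nothing  (just _)     = no λ ()
matches? (just _) nothing      = no λ ()
matches? (just 𝟘) (just false) = yes is𝟘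
matches? (just 𝟘) (just true)  = no λ ()
matches? (just 𝟙) (just false) = no λ ()
matches? (just 𝟙) (just true)  = yes is𝟙
matches? (just ✱) (just _)     = yes is✱

matches-truth : ∀ α → Matches α (truth α)
matches-truth nothing  = undef
matches-truth (just 𝟘) = is𝟘
matches-truth (just 𝟙) = is𝟙
matches-truth (just ✱) = is✱

matches-<∣> : ∀ {α β r t} → Matches α r → (r ≡ nothing → Matches β t) → Matches (α <∣> β) (r <∣> t)
matches-<∣> undef m = m refl
matches-<∣> is𝟘   _ = is𝟘
matches-<∣> is𝟙   _ = is𝟙
matches-<∣> is✱   _ = is✱

<∣>-just : ∀ {X : Set} {r t : Maybe X} {x} → r ≡ just x → (r <∣> t) ≡ just x
<∣>-just refl = refl

nothing-<∣> : ∀ {X : Set} (r t : Maybe X) → (r <∣> t) ≡ nothing → r ≡ nothing × t ≡ nothing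
nothing-<∣> nothing t eq = refl , eq

matches-nothing : ∀ {α} → Matches α nothing → α ≡ nothing
matches-nothing undef = refl

-- Merging changes a value at most into `✱`, which matches every defined value; the condition on
-- domains keeps an undefined entry undefined.
matches-merge : ∀ {μ σ r} → Matches μ r → (μ ≡ nothing → σ ≡ nothing) →
  Matches (if eqM μ σ then μ else just ✱) r
matches-merge {σ = nothing} undef _ = undef
matches-merge {σ = just _}  undef h = case h refl of λ ()
matches-merge {σ = nothing}  is𝟘 _ = is✱
matches-merge {σ = just 𝟘}   is𝟘 _ = is𝟘
matches-merge {σ = just 𝟙}   is𝟘 _ = is✱
matches-merge {σ = just ✱}   is𝟘 _ = is✱
matches-merge {σ = nothing}  is𝟙 _ = is✱
matches-merge {σ = just 𝟘}   is𝟙 _ = is✱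
matches-merge {σ = just 𝟙}   is𝟙 _ = is𝟙
matches-merge {σ = just ✱}   is𝟙 _ = is✱
matches-merge {σ = nothing}  is✱ _ = is✱
matches-merge {σ = just 𝟘}   is✱ _ = is✱
matches-merge {σ = just 𝟙}   is✱ _ = is✱
matches-merge {σ = just ✱}   is✱ _ = is✱

eqM-comm : ∀ μ σ → (if eqM μ σ then μ else just ✱) ≡ (if eqM σ μ then σ else just ✱)
eqM-comm nothing  nothing  = refl
eqM-comm nothing  (just 𝟘) = refl
eqM-comm nothing  (just 𝟙) = refl
eqM-comm nothing  (just ✱) = refl
eqM-comm (just 𝟘) nothing  = refl
eqM-comm (just 𝟙) nothing  = refl
eqM-comm (just ✱) nothing  = refl
eqM-comm (just 𝟘) (just 𝟘) = refl
eqM-comm (just 𝟘) (just 𝟙) = refl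
eqM-comm (just 𝟘) (just ✱) = refl
eqM-comm (just 𝟙) (just 𝟘) = refl
eqM-comm (just 𝟙) (just 𝟙) = refl
eqM-comm (just 𝟙) (just ✱) = refl
eqM-comm (just ✱) (just 𝟘) = refl
eqM-comm (just ✱) (just 𝟙) = refl
eqM-comm (just ✱) (just ✱) = refl

-- Two pivot annotations τ ∪ ξ and τ ∪ σ with disjoint parts, matched by r and t.
pivot-agree : ∀ {τ ξ σ r t} → τ ≢ just ✱ → ξ ≡ nothing ⊎ σ ≡ nothing →
  Matches (τ <∣> ξ) r → Matches (τ <∣> σ) t → (r <∣> t) ≡ (t <∣> r)
pivot-agree {just 𝟘} _ _ is𝟘 is𝟘 = refl
pivot-agree {just 𝟙} _ _ is𝟙 is𝟙 = refl
pivot-agree {just ✱} ≢✱ _ _ _ = contradiction refl ≢✱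
pivot-agree {nothing} {r = r} {nothing} _ (inj₁ refl) undef m = sym (<∣>-identityʳ _)
pivot-agree {nothing} {r = r} {just _} _ (inj₁ refl) undef m = refl
pivot-agree {nothing} {r = nothing} _ (inj₂ refl) m undef = refl
pivot-agree {nothing} {r = just _} _ (inj₂ refl) m undef = refl

module IRM-Interpolation (n m₁ m₂ : ℕ) (B : CNF (BVar n m₁ m₂)) where

  open Interpolation n m₁ m₂ B
  open QBF Φ
  open IRM Φ
  open ALit

  gate : ∀ {prev C} → IStep prev C → Gate Edge (length prev)
  gate (axiom M M∈ _ _)                              = axiomGate M∈
  gate (instantiate D D∈ _ _ _ _)                    = copy (index D∈)
  gate (resolve _ _ D₁∈ D₂∈ x _ _ _ _ _ _ _ _ _ _)   = pivotGate x (index D₁∈) (index D₂∈)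
  gate (merge D D∈ _ _ _ _ _ _ _ _)                  = copy (index D∈)

  prog : ∀ {cs} → Derivation cs → Prog Edge (length cs)
  prog []       = []
  prog (st ∷ δ) = gate st ∷ prog δ

  Assignment : Set
  Assignment = Fin m₁ → Maybe Bool

  _extends_ : (Fin m₁ → Bool) → Assignment → Set
  s extends ρ = ∀ {j b} → ρ j ≡ just b → s j ≡ b

  _fits_ : Ann → Assignment → Set
  α fits ρ = ∀ j → Matches (α (vr₁ j)) (ρ j)

  fits? : ∀ α ρ → Dec (α fits ρ)
  fits? α ρ = all? λ j → matches? (α (vr₁ j)) (ρ j)

  _◃_ : Assignment → Ann → Assignment
  (ρ ◃ σ) j = ρ j <∣> truth (σ (vr₁ j))

  ext-r₁ : ∀ {α σ} k j → ext (vr₂ k) σ α (vr₁ j) ≡ (α (vr₁ j) <∣> σ (vr₁ j))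
  ext-r₁ {α} {σ} k j = cong (α (vr₁ j) <∣>_) (if-yes (<⇒<ᵇ (ind-r₁<r₂ j k)))

  AllOf : (V → Bool → Set) → IClause → Set
  AllOf F C = ∀ {l} → C l → F (var l) (pol l)

  ≈L-refl : ∀ {l} → l ≈L l
  ≈L-refl = refl , refl , λ _ → refl

  same-literal? : ∀ (l : ALit) x p → Dec (var l ≡ x × pol l ≡ p)
  same-literal? l x p = (var l ≟ᵛ x) ×-dec (pol l ≟ᵇ p)

  -- The predicate `F` does not see annotations, so `F x p` also covers literals that share variable
  -- and polarity with the pivot but remain in the resolvent.
  AllOf-pivot : ∀ {F : V → Bool → Set} {D C : IClause} {x p α σ} →
    (∀ l → D l → ¬ (l ≈L ⟨ x , p , α ⟩) → C (instL σ l)) → F x p → AllOf F C → AllOf F D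
  AllOf-pivot {x = x} {p} kept Fx FC {l} Dl with same-literal? l x p
  ... | yes (refl , refl) = Fx
  ... | no  differs       = FC (kept l Dl λ (v≡ , p≡ , _) → differs (v≡ , p≡))

  AllOf-merge : ∀ {F : V → Bool → Set} {D C : IClause} {b p μ σ} →
    (∀ l → D l → ¬ (l ≈L ⟨ b , p , μ ⟩) → ¬ (l ≈L ⟨ b , p , σ ⟩) → C l) → C ⟨ b , p , mergeAnn μ σ ⟩ →
    AllOf F C → AllOf F D
  AllOf-merge {b = b} {p} kept merged FC {l} Dl with same-literal? l b p
  ... | yes (refl , refl) = FC merged
  ... | no  differs       = FC (kept l Dl (λ (v≡ , p≡ , _) → differs (v≡ , p≡)) (λ (v≡ , p≡ , _) → differs (v≡ , p≡)))

  _∈M?_ : (l : Lit V) (M : List (Lit V)) → Dec (l ∈ M)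
  _∈M?_ = _∈?_ (≡-dec _≟ᵛ_ _≟ᵇ_)

  falsifying : List (Lit V) → V → Maybe V3
  falsifying M u with (u , true) ∈M? M | (u , false) ∈M? M
  ... | yes _ | _     = just 𝟘
  ... | no _  | yes _ = just 𝟙
  ... | no _  | no _  = nothing

  -- Clauses are predicates here, so membership of a literal in an axiom has to be shown with an
  -- explicitly computed annotation.
  axiomAnn : List (Lit V) → V → Ann
  axiomAnn M e u with quant u | ind u <? ind e
  ... | ∀q | yes _ = falsifying M u
  ... | _  | _     = nothing

  axiomAnn-correct : ∀ M e u → AxAnn M e u (axiomAnn M e u)
  axiomAnn-correct M e u with quant u in ∀u | ind u <? ind e
  ... | ∃q | _ = aN λ ∀u' _ → case trans (sym ∀u) ∀u' of λ ()
  ... | ∀q | no u≮e = aN λ _ u<e → contradiction u<e u≮e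
  ... | ∀q | yes u<e with (u , true) ∈M? M | (u , false) ∈M? M
  ...   | yes u∈ | _      = a0 ∀u u<e u∈
  ...   | no _   | yes u∈ = a1 ∀u u<e u∈
  ...   | no u∉  | no u∉' = aN λ _ _ → [ u∉ , u∉' ]

  axiomAnn-r₂ : ∀ M k j → axiomAnn M (vr₂ k) (vr₁ j) ≡ falsifying M (vr₁ j)
  axiomAnn-r₂ M k j with ind (vr₁ j) <? ind (vr₂ k)
  ... | yes _ = refl
  ... | no ≮  = contradiction (ind-r₁<r₂ j k) ≮

  module _ (a : PAssign n) where

    FalseA : (Fin (n / 2) → Fin n → Bool) → V → Bool → Set
    FalseA s (vp v u) true = a v u ≢ true
    FalseA s (vq i u) b    = s i u ≢ b
    FalseA s _        _    = ⊤

    FalseP : V → Bool → Set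
    FalseP (vp v u) b = a v u ≢ b
    FalseP _        _ = ⊤

    FalseR : (Fin m₂ → Bool) → V → Bool → Set
    FalseR s₂ (vr₂ j) b = s₂ j ≢ b
    FalseR s₂ _       _ = ⊤

    FollowsFrom-A : IClause → Set
    FollowsFrom-A C = ∀ s → Sat (aAssign a s) (A n) → ¬ AllOf (FalseA s) C

    -- Once p is fixed, all surviving r₂-literals of a clause carry one common
    -- annotation without ✱; a ✱ only records which premise was discarded.
    Valid : IClause → Assignment → Set
    Valid C ρ = ∀ {s₁} → s₁ extends ρ → ∀ s₂ → Sat (bAssign a s₁ s₂) B →
      ¬ (∀ {l} → C l → ann l fits ρ → FalseR s₂ (var l) (pol l))

    FollowsFrom-B : IClause → Set
    FollowsFrom-B C = AllOf FalseP C → ∃ (Valid C)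

    axiom-A : ∀ {M C} → M ∈ embCNF embA (A n) → (∀ l → C l ⇔ AxLit M l) → FollowsFrom-A C
    axiom-A {M} {C} M∈ isAxiom s sat false-C = falsified-clause embA sat M∈ literal
      where
      inC : ∀ v b → quant v ≡ ∃q → (v , b) ∈ M → FalseA s v b
      inC v b ∃v l∈ = false-C (proj₂ (isAxiom ⟨ v , b , axiomAnn M v ⟩) (∃v , l∈ , axiomAnn-correct M v))
      literal : ∀ {l} → l ∈ concatMap id (A n) → (embA (proj₁ l) , proj₂ l) ∈ M → aAssign a s (proj₁ l) ≢ proj₂ l
      literal {ap v u , true}  _   l∈   = inC (vp v u) true refl l∈
      literal {ap v u , false} l∈A _  _ = case All.lookup (Allₚ.concat⁺ (Allₚ.map⁺ (A-monotone n))) l∈A of λ ()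
      literal {aq i u , b}     _   l∈   = inC (vq i u) b refl l∈

    axiom-B : ∀ {M C} → M ∈ embCNF embB B →
      (∀ u → quant u ≡ ∀q → (u , true) ∈ M → (u , false) ∈ M → ⊥) → (∀ l → C l ⇔ AxLit M l) → FollowsFrom-B C
    axiom-B {M} {C} M∈ consistent isAxiom falseP = (λ j → truth (falsifying M (vr₁ j))) , valid
      where
      inC : ∀ v b → quant v ≡ ∃q → (v , b) ∈ M → C ⟨ v , b , axiomAnn M v ⟩
      inC v b ∃v l∈ = proj₂ (isAxiom ⟨ v , b , axiomAnn M v ⟩) (∃v , l∈ , axiomAnn-correct M v)
      falsifying-r₁ : ∀ j b → (vr₁ j , b) ∈ M → truth (falsifying M (vr₁ j)) ≡ just (not b)
      falsifying-r₁ j b l∈ with (vr₁ j , true) ∈M? M | (vr₁ j , false) ∈M? M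
      falsifying-r₁ j true  l∈ | yes _   | _     = refl
      -- `falsifying` looks for the positive literal before the negative one; a universal variable
      -- of both polarities is excluded by the axiom rule.
      falsifying-r₁ j false l∈ | yes l∈' | _     = ⊥-elim (consistent (vr₁ j) refl l∈' l∈)
      falsifying-r₁ j true  l∈ | no l∉   | _     = contradiction l∈ l∉
      falsifying-r₁ j false l∈ | no _    | yes _ = refl
      falsifying-r₁ j false l∈ | no _    | no l∉ = contradiction l∈ l∉
      valid : Valid C (λ j → truth (falsifying M (vr₁ j)))
      valid {s₁} ext s₂ sat falseR = falsified-clause embB sat M∈ literal
        where
        literal : ∀ {l} → l ∈ concatMap id B → (embB (proj₁ l) , proj₂ l) ∈ M → bAssign a s₁ s₂ (proj₁ l) ≢ proj₂ l
        literal {bp v u , b} _ l∈ = falseP (inC (vp v u) b refl l∈)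
        literal {br₁ j , b}  _ l∈ = λ eq → not-¬ eq (ext (falsifying-r₁ j b l∈))
        literal {br₂ k , b}  _ l∈ = falseR (inC (vr₂ k) b refl l∈)
          (λ j → subst (λ α → Matches α (truth (falsifying M (vr₁ j)))) (sym (axiomAnn-r₂ M k j)) (matches-truth _))

    fits-ext : ∀ {α : Ann} {ρ : Assignment} {σ : Ann} {ρ' : Assignment} {k} → (∀ j → Matches (α (vr₁ j) <∣> σ (vr₁ j)) (ρ j <∣> ρ' j)) →
      ext (vr₂ k) σ α fits (λ j → ρ j <∣> ρ' j)
    fits-ext {α} {ρ} {σ} {ρ'} {k} m j =
      subst (λ β → Matches β (ρ j <∣> ρ' j)) (sym (ext-r₁ {α} {σ} k j)) (m j)

    FalseFitting : (Fin m₂ → Bool) → IClause → Assignment → Set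
    FalseFitting s₂ C ρ = ∀ {l} → C l → ann l fits ρ → FalseR s₂ (var l) (pol l)

    -- A literal of `D` that fits `ρ` is either false already, as a resolved pivot, or enters `C`
    -- with an annotation extended by `σ`. The extended annotation fits the extended assignment, so
    -- its falsity in `C` carries back to `D`.
    pull-back : ∀ {D C : IClause} {ρ ρ' : Assignment} {s₂} σ →
      (∀ {l k} → D l → ann l fits ρ → var l ≡ vr₂ k → C (instL σ l) ⊎ FalseR s₂ (var l) (pol l)) →
      (∀ j → ρ j ≡ nothing → Matches (σ (vr₁ j)) (ρ' j)) →
      FalseFitting s₂ C (λ j → ρ j <∣> ρ' j) → FalseFitting s₂ D ρ
    pull-back {ρ = ρ} {ρ'} σ kept mσ falseC {⟨ vr₂ k , p , α ⟩} Dl fit with kept Dl fit refl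
    ... | inj₂ false-l = false-l
    ... | inj₁ Cl      = falseC Cl (fits-ext {α} {ρ} {σ} {ρ'} λ j → matches-<∣> (fit j) (mσ j))
    pull-back σ kept mσ falseC {⟨ vp _ _ , _ , _ ⟩} _ _ = tt
    pull-back σ kept mσ falseC {⟨ vq _ _ , _ , _ ⟩} _ _ = tt
    pull-back σ kept mσ falseC {⟨ vr₁ _ , _ , _ ⟩}  _ _ = tt

    -- A ✱ in σ may be read as either value.
    valid-◃ : ∀ {D C : IClause} {ρ} σ →
      (∀ {l k} → D l → ann l fits ρ → var l ≡ vr₂ k → C (instL σ l)) → Valid D ρ → Valid C (ρ ◃ σ)
    valid-◃ {D} {C} {ρ} σ kept valid s₁⊇ρ s₂ sat falseC = valid (λ eq → s₁⊇ρ (<∣>-just eq)) s₂ sat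
      (pull-back {D} {C} {ρ} {λ j → truth (σ (vr₁ j))} {s₂} σ (λ Dl fit v≡ → inj₁ (kept Dl fit v≡)) (λ j _ → matches-truth (σ (vr₁ j))) falseC)

    fits-≈ : ∀ {l l' ρ} → l ≈L l' → ann l fits ρ → ann l' fits ρ
    fits-≈ {ρ = ρ} (_ , _ , ann≡) fit j = subst (λ α → Matches α (ρ j)) (ann≡ (vr₁ j)) (fit j)

    valid-merge : ∀ {D C : IClause} {b p μ σ ρ} → (∀ u → (μ u ≡ nothing) ⇔ (σ u ≡ nothing)) →
      (∀ l → D l → ¬ (l ≈L ⟨ b , p , μ ⟩) → ¬ (l ≈L ⟨ b , p , σ ⟩) → C l) → C ⟨ b , p , mergeAnn μ σ ⟩ →
      Valid D ρ → Valid C ρ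
    valid-merge {D} {C} {b} {p} {μ} {σ} {ρ} dom kept merged valid s₁⊇ρ s₂ sat falseC = valid s₁⊇ρ s₂ sat falseD
      where
      falseD : ∀ {l} → D l → ann l fits ρ → FalseR s₂ (var l) (pol l)
      falseD {⟨ vp _ _ , _ , _ ⟩} _ _ = tt
      falseD {⟨ vq _ _ , _ , _ ⟩} _ _ = tt
      falseD {⟨ vr₁ _ , _ , _ ⟩}  _ _ = tt
      falseD {l@(⟨ vr₂ k , q , α ⟩)} Dl fit true-l = falseC (kept l Dl not-μ not-σ) fit true-l
        where
        contradicts : ⟨ b , p , mergeAnn μ σ ⟩ .ann fits ρ → vr₂ k ≡ b → q ≡ p → ⊥
        contradicts fit refl refl = falseC merged fit true-l
        not-μ : ¬ (l ≈L ⟨ b , p , μ ⟩)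
        not-μ ≈ = contradicts (λ j → matches-merge (fits-≈ {l} ≈ fit j) (proj₁ (dom (vr₁ j)))) (proj₁ ≈) (proj₁ (proj₂ ≈))
        not-σ : ¬ (l ≈L ⟨ b , p , σ ⟩)
        not-σ ≈ = contradicts
          (λ j → subst (λ α → Matches α (ρ j)) (eqM-comm (σ (vr₁ j)) (μ (vr₁ j)))
                   (matches-merge (fits-≈ {l} ≈ fit j) (proj₂ (dom (vr₁ j))))) (proj₁ ≈) (proj₁ (proj₂ ≈))

    module Resolution {D₁ D₂ C : IClause} {x : V} {τ ξ σ : Ann}
      (kept₁ : ∀ l → D₁ l → ¬ (l ≈L ⟨ x , true , τ ∪ ξ ⟩) → C (instL σ l))
      (kept₂ : ∀ l → D₂ l → ¬ (l ≈L ⟨ x , false , τ ∪ σ ⟩) → C (instL ξ l)) where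

      from₁-A : ∀ {s} → FalseA s x true → AllOf (FalseA s) C → AllOf (FalseA s) D₁
      from₁-A {s} = AllOf-pivot {FalseA s} kept₁

      from₂-A : ∀ {s} → FalseA s x false → AllOf (FalseA s) C → AllOf (FalseA s) D₂
      from₂-A {s} = AllOf-pivot {FalseA s} kept₂

      from₁-B : (∀ k → vr₂ k ≢ x) → FalseP x true → FollowsFrom-B D₁ → FollowsFrom-B C
      from₁-B r₂≢x Fx ih falseP with ih (AllOf-pivot {FalseP} kept₁ Fx (λ {l} → falseP {l}))
      ... | ρ , valid = ρ ◃ σ , valid-◃ σ
        (λ {l} {k} Dl _ v≡ → kept₁ l Dl λ ≈ → r₂≢x k (trans (sym v≡) (proj₁ ≈))) valid

      from₂-B : (∀ k → vr₂ k ≢ x) → FalseP x false → FollowsFrom-B D₂ → FollowsFrom-B C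
      from₂-B r₂≢x Fx ih falseP with ih (AllOf-pivot {FalseP} kept₂ Fx (λ {l} → falseP {l}))
      ... | ρ , valid = ρ ◃ ξ , valid-◃ ξ
        (λ {l} {k} Dl _ v≡ → kept₂ l Dl λ ≈ → r₂≢x k (trans (sym v≡) (proj₁ ≈))) valid

      -- If an assignment does not fit the annotation of its pivot, the pivot is not among the
      -- surviving literals and that premise alone suffices. If both fit, they agree: on the domain
      -- of `τ` both equal `τ`, and elsewhere at most one is defined. Their union then serves, and
      -- the value of the pivot selects the premise.
      both-B : ∀ {k} → x ≡ vr₂ k → (∀ u → τ u ≢ just ✱) → Disjoint ξ σ →
        ∃ (Valid D₁) → ∃ (Valid D₂) → ∃ (Valid C)
      both-B {k} refl ≢✱ disjoint (ρ₁ , valid₁) (ρ₂ , valid₂) with fits? (τ ∪ ξ) ρ₁ | fits? (τ ∪ σ) ρ₂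
      ... | no ∌  | _     = ρ₁ ◃ σ , valid-◃ σ (λ {l} Dl fit _ → kept₁ l Dl λ ≈ → ∌ (fits-≈ {l} ≈ fit)) valid₁
      ... | yes _ | no ∌  = ρ₂ ◃ ξ , valid-◃ ξ (λ {l} Dl fit _ → kept₂ l Dl λ ≈ → ∌ (fits-≈ {l} ≈ fit)) valid₂
      ... | yes fit₁ | yes fit₂ = ρ , valid
        where
        ρ : Assignment
        ρ j = ρ₁ j <∣> ρ₂ j
        comm : ∀ j → ρ j ≡ (ρ₂ j <∣> ρ₁ j)
        comm j = pivot-agree (≢✱ (vr₁ j)) (disjoint (vr₁ j)) (fit₁ j) (fit₂ j)
        -- Where `r` is undefined, `τ` is undefined as well, so there `τ ∪ θ` is just `θ`.
        rest : ∀ {η θ : Ann} {r r' : Assignment} → (τ ∪ η) fits r → (τ ∪ θ) fits r' →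
          ∀ j → r j ≡ nothing → Matches (θ (vr₁ j)) (r' j)
        rest {η} {θ} {r} {r'} fit fit' j r≡ = subst (λ t → Matches (t <∣> θ (vr₁ j)) (r' j)) τ≡ (fit' j)
          where
          τ≡ : τ (vr₁ j) ≡ nothing
          τ≡ = proj₁ (nothing-<∣> (τ (vr₁ j)) (η (vr₁ j))
                 (matches-nothing (subst (Matches ((τ ∪ η) (vr₁ j))) r≡ (fit j))))
        unless-pivot : ∀ {D : IClause} {θ α : Ann} {p} {s₂ : Fin m₂ → Bool} → s₂ k ≢ p →
          (∀ l → D l → ¬ (l ≈L ⟨ vr₂ k , p , α ⟩) → C (instL θ l)) →
          ∀ {l} → D l → C (instL θ l) ⊎ FalseR s₂ (var l) (pol l)
        unless-pivot {p = p} false-p kept {l} Dl with same-literal? l (vr₂ k) p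
        ... | yes (refl , refl) = inj₂ false-p
        ... | no differs        = inj₁ (kept l Dl λ (v≡ , p≡ , _) → differs (v≡ , p≡))
        valid : Valid C ρ
        valid {s₁} s₁⊇ρ s₂ sat falseC = go (s₂ k) refl
          where
          go : ∀ b → s₂ k ≡ b → ⊥
          go false eq = valid₁ (λ e → s₁⊇ρ (<∣>-just e)) s₂ sat
            (pull-back {D₁} {C} {ρ₁} {ρ₂} {s₂} σ
              (λ Dl _ _ → unless-pivot {D₁} (λ eq' → case trans (sym eq) eq' of λ ()) kept₁ Dl)
              (rest {ξ} {σ} {ρ₁} {ρ₂} fit₁ fit₂) falseC)
          go true eq = valid₂ (λ {j} e → s₁⊇ρ (trans (comm j) (<∣>-just e))) s₂ sat
            (pull-back {D₂} {C} {ρ₂} {ρ₁} {s₂} ξ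
              (λ Dl _ _ → unless-pivot {D₂} (λ eq' → case trans (sym eq) eq' of λ ()) kept₂ Dl)
              (rest {σ} {ξ} {ρ₂} {ρ₁} fit₂ fit₁)
              (λ {l} Cl fit → falseC Cl λ j → subst (Matches (ann l (vr₁ j))) (sym (comm j)) (fit j)))

    module _ {D₁ D₂ C : IClause} where

      resolve-A : ∀ x {τ ξ σ : Ann} →
        (∀ l → D₁ l → ¬ (l ≈L ⟨ x , true , τ ∪ ξ ⟩) → C (instL σ l)) →
        (∀ l → D₂ l → ¬ (l ≈L ⟨ x , false , τ ∪ σ ⟩) → C (instL ξ l)) →
        ∀ {l} (val : Fin l → Bool) i j →
        (val i ≡ false → FollowsFrom-A D₁) → (val j ≡ false → FollowsFrom-A D₂) →
        gateVal (uncurry a) val (pivotGate x i j) ≡ false → FollowsFrom-A C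
      resolve-A x@(vp v u) {τ} {ξ} {σ} kept₁ kept₂ val i j ih₁ ih₂ eq s sat falseC with val j in eqj | a v u in eqa | val i in eqi
      ... | false | _     | _     = ih₂ refl s sat (from₂-A tt falseC)
        where open Resolution {D₁} {D₂} {C} {x} {τ} {ξ} {σ} kept₁ kept₂
      ... | true  | false | false = ih₁ refl s sat (from₁-A (λ eq' → case trans (sym eqa) eq' of λ ()) falseC)
        where open Resolution {D₁} {D₂} {C} {x} {τ} {ξ} {σ} kept₁ kept₂
      resolve-A x@(vq k u) {τ} {ξ} {σ} kept₁ kept₂ val i j ih₁ ih₂ eq s sat falseC with val i in eqi | val j in eqj | s k u in eqs
      ... | false | false | false = ih₁ refl s sat (from₁-A (λ eq' → case trans (sym eqs) eq' of λ ()) falseC)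
        where open Resolution {D₁} {D₂} {C} {x} {τ} {ξ} {σ} kept₁ kept₂
      ... | false | false | true  = ih₂ refl s sat (from₂-A (λ eq' → case trans (sym eqs) eq' of λ ()) falseC)
        where open Resolution {D₁} {D₂} {C} {x} {τ} {ξ} {σ} kept₁ kept₂
      resolve-A x@(vr₁ _) {τ} {ξ} {σ} kept₁ kept₂ val i j ih₁ ih₂ eq s sat falseC with val i in eqi | val j in eqj
      ... | false | _     = ih₁ refl s sat (from₁-A tt falseC)
        where open Resolution {D₁} {D₂} {C} {x} {τ} {ξ} {σ} kept₁ kept₂
      ... | true  | false = ih₂ refl s sat (from₂-A tt falseC)
        where open Resolution {D₁} {D₂} {C} {x} {τ} {ξ} {σ} kept₁ kept₂
      resolve-A x@(vr₂ _) {τ} {ξ} {σ} kept₁ kept₂ val i j ih₁ ih₂ eq s sat falseC with val i in eqi | val j in eqj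
      ... | false | _     = ih₁ refl s sat (from₁-A tt falseC)
        where open Resolution {D₁} {D₂} {C} {x} {τ} {ξ} {σ} kept₁ kept₂
      ... | true  | false = ih₂ refl s sat (from₂-A tt falseC)
        where open Resolution {D₁} {D₂} {C} {x} {τ} {ξ} {σ} kept₁ kept₂

      resolve-B : ∀ x {τ ξ σ : Ann} → (∀ u → τ u ≢ just ✱) → Disjoint ξ σ →
        (∀ l → D₁ l → ¬ (l ≈L ⟨ x , true , τ ∪ ξ ⟩) → C (instL σ l)) →
        (∀ l → D₂ l → ¬ (l ≈L ⟨ x , false , τ ∪ σ ⟩) → C (instL ξ l)) →
        ∀ {l} (val : Fin l → Bool) i j →
        (val i ≡ true → FollowsFrom-B D₁) → (val j ≡ true → FollowsFrom-B D₂) →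
        gateVal (uncurry a) val (pivotGate x i j) ≡ true → FollowsFrom-B C
      resolve-B x@(vp v u) {τ} {ξ} {σ} _ _ kept₁ kept₂ val i j ih₁ ih₂ eq with val j in eqj | a v u in eqa | val i in eqi
      ... | true | true  | _    = from₂-B (λ _ ()) (λ eq' → case trans (sym eqa) eq' of λ ()) (ih₂ refl)
        where open Resolution {D₁} {D₂} {C} {x} {τ} {ξ} {σ} kept₁ kept₂
      ... | true | false | true = from₁-B (λ _ ()) (λ eq' → case trans (sym eqa) eq' of λ ()) (ih₁ refl)
        where open Resolution {D₁} {D₂} {C} {x} {τ} {ξ} {σ} kept₁ kept₂
      resolve-B x@(vq k u) {τ} {ξ} {σ} _ _ kept₁ kept₂ val i j ih₁ ih₂ eq with val i in eqi | val j in eqj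
      ... | true  | _    = from₁-B (λ _ ()) tt (ih₁ refl)
        where open Resolution {D₁} {D₂} {C} {x} {τ} {ξ} {σ} kept₁ kept₂
      ... | false | true = from₂-B (λ _ ()) tt (ih₂ refl)
        where open Resolution {D₁} {D₂} {C} {x} {τ} {ξ} {σ} kept₁ kept₂
      resolve-B x@(vr₁ k) {τ} {ξ} {σ} _ _ kept₁ kept₂ val i j ih₁ ih₂ eq with val i in eqi | val j in eqj
      ... | true | true = from₁-B (λ _ ()) tt (ih₁ refl)
        where open Resolution {D₁} {D₂} {C} {x} {τ} {ξ} {σ} kept₁ kept₂
      resolve-B x@(vr₂ k) {τ} {ξ} {σ} ≢✱ disjoint kept₁ kept₂ val i j ih₁ ih₂ eq falseP with val i in eqi | val j in eqj
      ... | true | true = both-B refl ≢✱ disjoint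
          (ih₁ refl (AllOf-pivot {FalseP} kept₁ tt (λ {l} → falseP {l}))) (ih₂ refl (AllOf-pivot {FalseP} kept₂ tt (λ {l} → falseP {l})))
        where open Resolution {D₁} {D₂} {C} {x} {τ} {ξ} {σ} kept₁ kept₂

    step-A : ∀ {prev C} (st : IStep prev C) (val : Fin (length prev) → Bool) →
      (∀ {D} (D∈ : D ∈ prev) → val (index D∈) ≡ false → FollowsFrom-A D) →
      gateVal (uncurry a) val (gate st) ≡ false → FollowsFrom-A C
    step-A (axiom M M∈ _ isAxiom) val ih eq with ∈-++⁻ (embCNF embA (A n)) M∈
    ... | inj₁ M∈A = axiom-A M∈A isAxiom
    step-A (instantiate D D∈ τ _ _ isInst) val ih eq s sat falseC =
      ih D∈ eq s sat λ {l} Dl → falseC (proj₂ (isInst (instL τ l)) (l , Dl , ≈L-refl {instL τ l}))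
    step-A (resolve D₁ D₂ D₁∈ D₂∈ x τ ξ σ _ _ _ _ _ _ isRes) val ih eq =
      resolve-A x {τ} {ξ} {σ}
        (λ l Dl ≉ → proj₂ (isRes (instL σ l)) (inj₁ (l , Dl , ≉ , ≈L-refl {instL σ l})))
        (λ l Dl ≉ → proj₂ (isRes (instL ξ l)) (inj₂ (l , Dl , ≉ , ≈L-refl {instL ξ l})))
        val (index D₁∈) (index D₂∈) (ih D₁∈) (ih D₂∈) eq
    step-A (merge D D∈ b p μ σ _ _ dom isMerge) val ih eq s sat falseC = ih D∈ eq s sat
      (AllOf-merge {FalseA s} (λ l Dl ≉μ ≉σ → proj₂ (isMerge l) (inj₁ (Dl , ≉μ , ≉σ)))
        (proj₂ (isMerge _) (inj₂ (≈L-refl {⟨ b , p , mergeAnn μ σ ⟩}))) falseC)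

    step-B : ∀ {prev C} (st : IStep prev C) (val : Fin (length prev) → Bool) →
      (∀ {D} (D∈ : D ∈ prev) → val (index D∈) ≡ true → FollowsFrom-B D) →
      gateVal (uncurry a) val (gate st) ≡ true → FollowsFrom-B C
    step-B (axiom M M∈ consistent isAxiom) val ih eq with ∈-++⁻ (embCNF embA (A n)) M∈
    ... | inj₂ M∈B = axiom-B M∈B consistent isAxiom
    step-B {C = C} (instantiate D D∈ τ _ _ isInst) val ih eq falseP = instantiated (ih D∈ eq (λ {l} Dl → falseP (inC l Dl)))
      where
      inC : ∀ l → D l → C (instL τ l)
      inC l Dl = proj₂ (isInst (instL τ l)) (l , Dl , ≈L-refl {instL τ l})
      instantiated : ∃ (Valid D) → ∃ (Valid C)
      instantiated (ρ , valid) = ρ ◃ τ , valid-◃ τ (λ {l} Dl _ _ → inC l Dl) valid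
    step-B (resolve D₁ D₂ D₁∈ D₂∈ x τ ξ σ ≢✱ _ _ disjoint _ _ isRes) val ih eq =
      resolve-B x {τ} {ξ} {σ} ≢✱ disjoint
        (λ l Dl ≉ → proj₂ (isRes (instL σ l)) (inj₁ (l , Dl , ≉ , ≈L-refl {instL σ l})))
        (λ l Dl ≉ → proj₂ (isRes (instL ξ l)) (inj₂ (l , Dl , ≉ , ≈L-refl {instL ξ l})))
        val (index D₁∈) (index D₂∈) (ih D₁∈) (ih D₂∈) eq
    step-B {C = C} (merge D D∈ b p μ σ _ _ dom isMerge) val ih eq falseP =
      merged (ih D∈ eq (AllOf-merge {FalseP} kept new falseP))
      where
      kept : ∀ l → D l → ¬ (l ≈L ⟨ b , p , μ ⟩) → ¬ (l ≈L ⟨ b , p , σ ⟩) → C l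
      kept l Dl ≉μ ≉σ = proj₂ (isMerge l) (inj₁ (Dl , ≉μ , ≉σ))
      new : C ⟨ b , p , mergeAnn μ σ ⟩
      new = proj₂ (isMerge _) (inj₂ (≈L-refl {⟨ b , p , mergeAnn μ σ ⟩}))
      merged : ∃ (Valid D) → ∃ (Valid C)
      merged (ρ , valid) = ρ , valid-merge dom kept new valid

    derived-A : ∀ {cs} (δ : Derivation cs) {C} (C∈ : C ∈ cs) →
      progVal (prog δ) (uncurry a) (index C∈) ≡ false → FollowsFrom-A C
    derived-A (st ∷ δ) (here refl) = step-A st (progVal (prog δ) (uncurry a)) (derived-A δ)
    derived-A (st ∷ δ) (there C∈)  = derived-A δ C∈

    derived-B : ∀ {cs} (δ : Derivation cs) {C} (C∈ : C ∈ cs) →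
      progVal (prog δ) (uncurry a) (index C∈) ≡ true → FollowsFrom-B C
    derived-B (st ∷ δ) (here refl) = step-B st (progVal (prog δ) (uncurry a)) (derived-B δ)
    derived-B (st ∷ δ) (there C∈)  = derived-B δ C∈

    module _ (π : Refutation) where
      open Refutation π

      interpolant-A : progVal (prog steps) (uncurry a) zero ≡ false → ¬ ∃ λ s → Sat (aAssign a s) (A n)
      interpolant-A eq (s , sat) = derived-A steps (here refl) eq s sat (λ {l} Cl → ⊥-elim (empty l Cl))

      interpolant-B : progVal (prog steps) (uncurry a) zero ≡ true → ¬ AllAnswered a
      interpolant-B eq answered with derived-B steps (here refl) eq (λ {l} Cl → ⊥-elim (empty l Cl))
      ... | ρ , valid with answered (λ j → fromMaybe false (ρ j))
      ...   | s₂ , sat = valid (λ e → cong (fromMaybe false) e) s₂ sat (λ {l} Cl → ⊥-elim (empty l Cl))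

-- Choice of the parameters and conclusion

room-for-padding : ∀ t n → 1 ≤ t → 544 ^ 5 ≤ n → t ^ 5 ≤ n →
  let Q = 4 * ((t + t) * (t + t)) in suc Q * Q ≤ n / 2
room-for-padding t n 1≤t N≤n t⁵≤n = subst (_≤ n / 2) (m*n/n≡m (suc Q * Q) 2) (/-monoˡ-≤ 2 (begin
  suc Q * Q * 2                               ≡⟨ expand t ⟩
  32 * (t * t) + 512 * (t * t * (t * t))      ≤⟨ +-monoˡ-≤ _ (*-monoʳ-≤ 32 (m≤m*n (t * t) (t * t) {{t²≢0}})) ⟩
  32 * (t * t * (t * t)) + 512 * (t * t * (t * t)) ≡⟨ *-distribʳ-+ (t * t * (t * t)) 32 512 ⟨
  544 * (t * t * (t * t))                     ≡⟨ cong (544 *_) (fourth t) ⟩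
  -- The constant 544 = 512 + 32 bounds twice the core by 544 t⁴. The threshold 544 ^ 5 covers small
  -- t, and for t ≥ 544 one more power of t absorbs the constant; hence the exponent 5.
  544 * t ^ 4                                 ≤⟨ [ (λ t≤544 → ≤-trans (*-monoʳ-≤ 544 (^-monoˡ-≤ 4 t≤544)) N≤n)
                                                 , (λ 544≤t → ≤-trans (*-monoˡ-≤ (t ^ 4) 544≤t) t⁵≤n) ]′ (≤-total t 544) ⟩
  n                                           ∎))
  where
  open ≤-Reasoning
  Q : ℕ
  Q = 4 * ((t + t) * (t + t))
  t²≢0 : NonZero (t * t)
  t²≢0 = >-nonZero (*-mono-≤ 1≤t 1≤t)
  expand : ∀ t → suc (4 * ((t + t) * (t + t))) * (4 * ((t + t) * (t + t))) * 2 ≡ 32 * (t * t) + 512 * (t * t * (t * t))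
  expand = solve-∀
  fourth : ∀ t → t * t * (t * t) ≡ t * (t * (t * (t * 1)))
  fourth = solve-∀

-- The core occupies at most half of the vertices, so the fewer than n / 2 universal vertices that
-- raise its clique size to n / 2 fit beside it, and isolated vertices fill the rest. The case t = 0
-- is apart because the approximation needs a positive depth.
clique-bound : ∀ n t → 544 ^ 5 ≤ n → t ^ 5 ≤ n → ∀ {l} (P : Prog (Σ (Fin n) (Fin ∘ toℕ)) (suc l)) →
  (∀ a → (∃ λ s → Sat (aAssign a s) (A n)) → progVal P (uncurry a) zero ≡ true) →
  (∀ a → (¬ ∃ λ s → Sat (aAssign a s) (A n)) → progVal P (uncurry a) zero ≡ false) →
  2 ^ t ≤ suc l
clique-bound n zero     N≤n t⁵≤n P accepts rejects = s≤s z≤n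
clique-bound n (suc ℓ') N≤n t⁵≤n P accepts rejects =
  Padding.clique-size-bound Q ℓ' refl ℓ≤k n c d (sym (m+[n∸m]≡n k≤h))
    (trans (sym (m+[n∸m]≡n fits)) (+-assoc (suc Q * Q) c d)) P accepts rejects
  where
  Q c d : ℕ
  Q = 4 * ((suc ℓ' + suc ℓ') * (suc ℓ' + suc ℓ'))
  c = n / 2 ∸ suc Q
  d = n ∸ (suc Q * Q + c)
  core≤h : suc Q * Q ≤ n / 2
  core≤h = room-for-padding (suc ℓ') n (s≤s z≤n) N≤n t⁵≤n
  k≤h : suc Q ≤ n / 2
  k≤h = ≤-trans (m≤m*n (suc Q) Q) core≤h
  ℓ≤k : suc ℓ' ≤ suc Q
  ℓ≤k = ≤-trans (m≤m+n (suc ℓ') (suc ℓ')) (≤-trans (m≤m*n _ (suc ℓ' + suc ℓ')) (≤-trans (m≤n*m _ 4) (n≤1+n Q)))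
  fits : suc Q * Q + c ≤ n
  fits = begin
    suc Q * Q + c   ≤⟨ +-mono-≤ core≤h (m∸n≤m (n / 2) (suc Q)) ⟩
    n / 2 + n / 2   ≡⟨ double (n / 2) ⟩
    n / 2 * 2       ≤⟨ m/n*n≤m n 2 ⟩
    n               ∎
    where
    open ≤-Reasoning
    double : ∀ h → h + h ≡ h * 2
    double = solve-∀

theorem4p2 : (m₁ m₂ : ℕ → ℕ) (B : (n : ℕ) → CNF (BVar n (m₁ n) (m₂ n))) →
    ∃ (λ c → ∀ n → 2 ∣ n → cnfSize (B n) ≤ c * n ^ c + c) →
    (∀ n → 2 ∣ n → (a : PAssign n) →
    (∀ (s₁ : Fin (m₁ n) → Bool) → ∃ (λ (s₂ : Fin (m₂ n) → Bool) → Sat (bAssign a s₁ s₂) (B n)))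
    ⇔ (¬ ∃ (λ s → Sat (aAssign a s) (A n)))) →
    ∃₂ (λ k N → ∀ n → 2 ∣ n → N ≤ n → ∀ t → t ^ k ≤ n →
    (∀ (π : IRM.Refutation (Phi n (m₁ n) (m₂ n) (B n))) → 2 ^ t ≤ IRM.size (Phi n (m₁ n) (m₂ n) (B n)) π)
    × (∀ (π : LQU.Refutation (Phi n (m₁ n) (m₂ n) (B n))) → 2 ^ t ≤ LQU.size (Phi n (m₁ n) (m₂ n) (B n)) π))
theorem4p2 m₁ m₂ B _ B-correct = 5 , 544 ^ 5 , λ n 2∣n N≤n t t⁵≤n →
  let open Interpolation n (m₁ n) (m₂ n) (B n)
      module Irm = IRM-Interpolation n (m₁ n) (m₂ n) (B n)
      module Lqu = LQU-Interpolation n (m₁ n) (m₂ n) (B n)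
      bound : ∀ {l} (P : Prog Edge (suc l)) →
        (∀ a → progVal P (uncurry a) zero ≡ false → ¬ ∃ λ s → Sat (aAssign a s) (A n)) →
        (∀ a → progVal P (uncurry a) zero ≡ true → ¬ AllAnswered a) → 2 ^ t ≤ suc l
      bound P to-A to-B = clique-bound n t N≤n t⁵≤n P
        -- The interpolants refute the wrong value of the output bit, and a bit that is not one
        -- value is the other. For graphs without a clique, the correctness of B supplies the
        -- answers that contradict bit 1.
        (λ a sat → ¬-not λ eq → to-A a eq sat)
        (λ a unsat → ¬-not λ eq → to-B a eq (proj₂ (B-correct n 2∣n a) unsat))
  in (λ π → bound (Irm.prog (IRM.Refutation.steps π)) (λ a → Irm.interpolant-A a π) (λ a → Irm.interpolant-B a π))
   , (λ π → bound (Lqu.prog (LQU.Refutation.steps π)) (λ a → Lqu.interpolant-A a π) (λ a → Lqu.interpolant-B a π))
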